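{- For every $\varepsilon\in(0,\tfrac12)$ there is an $n_0=n_0(\varepsilon)$ such that the following holds for all $n>n_0$. Let $G=(A,B;E_G)$ and $H=(S,T;E_H)$ be bipartite graphs with $|A|=|B|=|S|=|T|=n$ satisfying: (1) $d_G(x)>\left(\tfrac12+\varepsilon\right)n$ for all $x\in A\cup B$; (2) $d_H(x)<\dfrac{\varepsilon^4}{100}\cdot\dfrac{n}{\log n}$ for all $x\in S$; (3) $d_H(y)=1$ for all $y\in T$. Then $H\subseteq G$, i.e. $G$ contains a subgraph isomorphic to $H$ via an isomorphism mapping $S$ onto $A$ and $T$ onto $B$.
   Context: All graphs are simple. $d_G(v)$ denotes the degree of vertex $v$ in graph $G$. For a bipartite graph written $G=(A,B;E)$, $A$ and $B$ are its two vertex classes. -}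

module Defs where

open import Data.Bool.Base using (Bool; true)
open import Data.Fin.Base using (Fin)
open import Data.Fin.Permutation using (Permutation; _⟨$⟩ʳ_)
open import Data.Fin.Subset using (∣_∣)
open import Data.Integer.Base as ℤ using (+_; +[1+_]; -[1+_]; +≤+; +<+)
import Data.Integer.Properties as ℤ
open import Data.Nat.Base as ℕ using (ℕ; zero; suc; z≤n; s≤s; NonTrivial)
open import Data.Nat.Coprimality using (1-coprimeTo)
import Data.Nat.Properties as ℕ
open import Data.Product.Base using (Σ-syntax; ∃-syntax; _×_; _,_)
open import Data.Rational.Base as ℚ using (ℚ; mkℚ; 0ℚ; 1ℚ; ½; *≤*)
import Data.Rational.Properties as ℚ
open import Data.Rational.Solver using (module +-*-Solver)
open import Data.Sum.Base using (_⊎_; inj₁; inj₂)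
open import Data.Vec.Base using (tabulate)
open import Relation.Binary.PropositionalEquality.Core using (_≡_; refl; sym; trans; cong; cong₂; subst; subst₂)
open import Relation.Nullary using (yes; no; contradiction)

Cauchy : (ℕ → ℚ) → Set
Cauchy s = ∀ δ → 0ℚ ℚ.< δ → ∃[ N ] ∀ i j → N ℕ.≤ i → N ℕ.≤ j → ℚ.∣ s i ℚ.- s j ∣ ℚ.≤ δ

record ℝ : Set where
  constructor mkℝ
  field
    seq    : ℕ → ℚ
    cauchy : Cauchy seq

open ℝ public

infix 4 _<_

-- x < y iff some rational gap > 0 eventually separates the sequences, so
-- that < respects equality of limits.
record _<_ (x y : ℝ) : Set where
  constructor mk<
  field
    gap    : ℚ
    gap>0  : 0ℚ ℚ.< gap
    from   : ℕ
    spaced : ∀ i → from ℕ.≤ i → seq x i ℚ.+ gap ℚ.≤ seq y i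

open _<_ public

-- The total reciprocal, with value 0 at 0.
recip : ℚ → ℚ
recip p with p ℚ.≟ 0ℚ
... | yes _  = 0ℚ
... | no p≢0 = ℚ.1/_ p {{ℚ.≢-nonZero p≢0}}

module RealLemmas where

  open +-*-Solver using (solve; con; _:=_; _:+_; _:*_; _:-_; :-_)

  0<½ : 0ℚ ℚ.< ½
  0<½ = ℚ.positive⁻¹ ½

  halves : ∀ δ → ½ ℚ.* δ ℚ.+ ½ ℚ.* δ ≡ δ
  halves = solve 1 (λ d → con ½ :* d :+ con ½ :* d := d) refl

  *-pos : ∀ {p q} → 0ℚ ℚ.< p → 0ℚ ℚ.< q → 0ℚ ℚ.< p ℚ.* q
  *-pos {p} {q} 0<p 0<q = ℚ.positive⁻¹ (p ℚ.* q) {{ℚ.pos*pos⇒pos p {{ℚ.positive 0<p}} q {{ℚ.positive 0<q}}}}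

  *-mono : ∀ {p q r s} → 0ℚ ℚ.≤ p → 0ℚ ℚ.≤ s → p ℚ.≤ q → r ℚ.≤ s → p ℚ.* r ℚ.≤ q ℚ.* s
  *-mono {p} {q} {r} {s} 0≤p 0≤s p≤q r≤s = ℚ.≤-trans
    (ℚ.*-monoˡ-≤-nonNeg p {{ℚ.nonNegative 0≤p}} r≤s)
    (ℚ.*-monoʳ-≤-nonNeg s {{ℚ.nonNegative 0≤s}} p≤q)

  *-nonNeg : ∀ {p q} → 0ℚ ℚ.≤ p → 0ℚ ℚ.≤ q → 0ℚ ℚ.≤ p ℚ.* q
  *-nonNeg {p} {q} 0≤p 0≤q =
    subst (ℚ._≤ p ℚ.* q) (ℚ.*-zeroʳ p) (ℚ.*-monoˡ-≤-nonNeg p {{ℚ.nonNegative 0≤p}} 0≤q)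

  *-sub : ∀ {p q} r → 0ℚ ℚ.≤ r → p ℚ.≤ q → r ℚ.* p ℚ.≤ r ℚ.* q
  *-sub r 0≤r = ℚ.*-monoˡ-≤-nonNeg r {{ℚ.nonNegative 0≤r}}

  ∣sub∣-comm : ∀ p q → ℚ.∣ p ℚ.- q ∣ ≡ ℚ.∣ q ℚ.- p ∣
  ∣sub∣-comm p q = trans (cong ℚ.∣_∣ (solve 2 (λ a b → a :- b := :- (b :- a)) refl p q)) (ℚ.∣-p∣≡∣p∣ (q ℚ.- p))

  recip-inverse : ∀ p → 0ℚ ℚ.< p → p ℚ.* recip p ≡ 1ℚ
  recip-inverse p 0<p with p ℚ.≟ 0ℚ
  ... | yes refl = contradiction 0<p (ℚ.<-irrefl refl)
  ... | no p≢0   = ℚ.*-inverseʳ p {{ℚ.≢-nonZero p≢0}}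

  recip-pos : ∀ p → 0ℚ ℚ.< p → 0ℚ ℚ.< recip p
  recip-pos p 0<p = ℚ.*-cancelˡ-<-nonNeg p {{ℚ.nonNegative (ℚ.<⇒≤ 0<p)}}
    (subst₂ ℚ._<_ (sym (ℚ.*-zeroʳ p)) (sym (recip-inverse p 0<p)) (ℚ.positive⁻¹ 1ℚ))

  const-cauchy : ∀ q → Cauchy (λ _ → q)
  const-cauchy q δ 0<δ = 0 , λ _ _ _ _ → subst (ℚ._≤ δ) (sym (cong ℚ.∣_∣ (ℚ.+-inverseʳ q))) (ℚ.<⇒≤ 0<δ)

  +-cauchy : ∀ {s t} → Cauchy s → Cauchy t → Cauchy (λ i → s i ℚ.+ t i)
  +-cauchy {s} {t} cs ct δ 0<δ with cs (½ ℚ.* δ) (*-pos 0<½ 0<δ) | ct (½ ℚ.* δ) (*-pos 0<½ 0<δ)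
  ... | M , hM | N , hN = M ℕ.⊔ N , λ i j le₁ le₂ → begin
    ℚ.∣ (s i ℚ.+ t i) ℚ.- (s j ℚ.+ t j) ∣   ≡⟨ cong ℚ.∣_∣ (solve 4 (λ a b c d → (a :+ b) :- (c :+ d) := (a :- c) :+ (b :- d)) refl (s i) (t i) (s j) (t j)) ⟩
    ℚ.∣ (s i ℚ.- s j) ℚ.+ (t i ℚ.- t j) ∣   ≤⟨ ℚ.∣p+q∣≤∣p∣+∣q∣ (s i ℚ.- s j) (t i ℚ.- t j) ⟩
    ℚ.∣ s i ℚ.- s j ∣ ℚ.+ ℚ.∣ t i ℚ.- t j ∣ ≤⟨ ℚ.+-mono-≤ (hM i j (ℕ.m⊔n≤o⇒m≤o M N le₁) (ℕ.m⊔n≤o⇒m≤o M N le₂)) (hN i j (ℕ.m⊔n≤o⇒n≤o M N le₁) (ℕ.m⊔n≤o⇒n≤o M N le₂)) ⟩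
    ½ ℚ.* δ ℚ.+ ½ ℚ.* δ                     ≡⟨ halves δ ⟩
    δ                                       ∎
    where open ℚ.≤-Reasoning

  bounded : ∀ {s} → Cauchy s → ∃[ B ] 0ℚ ℚ.< B × ∃[ N ] ∀ i → N ℕ.≤ i → ℚ.∣ s i ∣ ℚ.≤ B
  bounded {s} cs with cs 1ℚ (ℚ.positive⁻¹ 1ℚ)
  ... | N , hN = 1ℚ ℚ.+ ℚ.∣ s N ∣ , ℚ.+-mono-<-≤ (ℚ.positive⁻¹ 1ℚ) (ℚ.0≤∣p∣ (s N)) , N , λ i le → begin
    ℚ.∣ s i ∣                         ≡⟨ cong ℚ.∣_∣ (solve 2 (λ a b → a := (a :- b) :+ b) refl (s i) (s N)) ⟩
    ℚ.∣ (s i ℚ.- s N) ℚ.+ s N ∣       ≤⟨ ℚ.∣p+q∣≤∣p∣+∣q∣ (s i ℚ.- s N) (s N) ⟩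
    ℚ.∣ s i ℚ.- s N ∣ ℚ.+ ℚ.∣ s N ∣   ≤⟨ ℚ.+-monoˡ-≤ ℚ.∣ s N ∣ (hN i N le ℕ.≤-refl) ⟩
    1ℚ ℚ.+ ℚ.∣ s N ∣                  ∎
    where open ℚ.≤-Reasoning

  *-bound : ∀ p q B δ → 0ℚ ℚ.< B → 0ℚ ℚ.< δ → 0ℚ ℚ.≤ p → p ℚ.≤ B → q ℚ.≤ recip B ℚ.* δ → p ℚ.* q ℚ.≤ δ
  *-bound p q B δ 0<B 0<δ 0≤p p≤B q≤ = begin
    p ℚ.* q                    ≤⟨ *-mono {p} {B} {q} {recip B ℚ.* δ} 0≤p (ℚ.<⇒≤ (*-pos (recip-pos B 0<B) 0<δ)) p≤B q≤ ⟩
    B ℚ.* (recip B ℚ.* δ)      ≡⟨ sym (ℚ.*-assoc B (recip B) δ) ⟩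
    (B ℚ.* recip B) ℚ.* δ      ≡⟨ cong (ℚ._* δ) (recip-inverse B 0<B) ⟩
    1ℚ ℚ.* δ                   ≡⟨ ℚ.*-identityˡ δ ⟩
    δ                          ∎
    where open ℚ.≤-Reasoning

  *-difference : ∀ a b c d → a ℚ.* b ℚ.- c ℚ.* d ≡ a ℚ.* (b ℚ.- d) ℚ.+ d ℚ.* (a ℚ.- c)
  *-difference = solve 4 (λ a b c d → a :* b :- c :* d := a :* (b :- d) :+ d :* (a :- c)) refl

  *-close : ∀ a b c d η → ℚ.∣ a ∣ ℚ.* ℚ.∣ b ℚ.- d ∣ ℚ.≤ η → ℚ.∣ d ∣ ℚ.* ℚ.∣ a ℚ.- c ∣ ℚ.≤ η →
            ℚ.∣ a ℚ.* b ℚ.- c ℚ.* d ∣ ℚ.≤ η ℚ.+ η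
  *-close a b c d η h₁ h₂ = begin
    ℚ.∣ a ℚ.* b ℚ.- c ℚ.* d ∣                               ≡⟨ cong ℚ.∣_∣ (*-difference a b c d) ⟩
    ℚ.∣ a ℚ.* (b ℚ.- d) ℚ.+ d ℚ.* (a ℚ.- c) ∣               ≤⟨ ℚ.∣p+q∣≤∣p∣+∣q∣ (a ℚ.* (b ℚ.- d)) (d ℚ.* (a ℚ.- c)) ⟩
    ℚ.∣ a ℚ.* (b ℚ.- d) ∣ ℚ.+ ℚ.∣ d ℚ.* (a ℚ.- c) ∣         ≡⟨ cong₂ ℚ._+_ (ℚ.∣p*q∣≡∣p∣*∣q∣ a (b ℚ.- d)) (ℚ.∣p*q∣≡∣p∣*∣q∣ d (a ℚ.- c)) ⟩
    ℚ.∣ a ∣ ℚ.* ℚ.∣ b ℚ.- d ∣ ℚ.+ ℚ.∣ d ∣ ℚ.* ℚ.∣ a ℚ.- c ∣ ≤⟨ ℚ.+-mono-≤ h₁ h₂ ⟩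
    η ℚ.+ η                                                 ∎
    where open ℚ.≤-Reasoning

  *-cauchy : ∀ {s t} → Cauchy s → Cauchy t → Cauchy (λ i → s i ℚ.* t i)
  *-cauchy {s} {t} cs ct δ 0<δ =
    let η = ½ ℚ.* δ
        0<η = *-pos 0<½ 0<δ
        B , 0<B , K , hK = bounded cs
        C , 0<C , L , hL = bounded ct
        M , hM = cs (recip C ℚ.* η) (*-pos (recip-pos C 0<C) 0<η)
        N , hN = ct (recip B ℚ.* η) (*-pos (recip-pos B 0<B) 0<η)
    in (K ℕ.⊔ L) ℕ.⊔ (M ℕ.⊔ N) , λ i j le₁ le₂ →
    let k≤i = ℕ.m⊔n≤o⇒m≤o K L (ℕ.m⊔n≤o⇒m≤o (K ℕ.⊔ L) (M ℕ.⊔ N) le₁)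
        l≤j = ℕ.m⊔n≤o⇒n≤o K L (ℕ.m⊔n≤o⇒m≤o (K ℕ.⊔ L) (M ℕ.⊔ N) le₂)
        mn≤i = ℕ.m⊔n≤o⇒n≤o (K ℕ.⊔ L) (M ℕ.⊔ N) le₁
        mn≤j = ℕ.m⊔n≤o⇒n≤o (K ℕ.⊔ L) (M ℕ.⊔ N) le₂
        ds = hM i j (ℕ.m⊔n≤o⇒m≤o M N mn≤i) (ℕ.m⊔n≤o⇒m≤o M N mn≤j)
        dt = hN i j (ℕ.m⊔n≤o⇒n≤o M N mn≤i) (ℕ.m⊔n≤o⇒n≤o M N mn≤j)
    in subst (ℚ.∣ s i ℚ.* t i ℚ.- s j ℚ.* t j ∣ ℚ.≤_) (halves δ)
      (*-close (s i) (t i) (s j) (t j) η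
        (*-bound ℚ.∣ s i ∣ ℚ.∣ t i ℚ.- t j ∣ B η 0<B 0<η (ℚ.0≤∣p∣ (s i)) (hK i k≤i) dt)
        (*-bound ℚ.∣ t j ∣ ℚ.∣ s i ℚ.- s j ∣ C η 0<C 0<η (ℚ.0≤∣p∣ (t j)) (hL j l≤j) ds))

  recip-cauchy : ∀ {s} c N → 0ℚ ℚ.< c → (∀ i → N ℕ.≤ i → c ℚ.≤ s i) → Cauchy s → Cauchy (λ i → recip (s i))
  recip-cauchy {s} c N 0<c c≤s cs δ 0<δ with cs (δ ℚ.* (c ℚ.* c)) (*-pos 0<δ (*-pos 0<c 0<c))
  ... | M , hM = N ℕ.⊔ M , λ i j le₁ le₂ →
    close (s i) (s j) (c≤s i (ℕ.m⊔n≤o⇒m≤o N M le₁)) (c≤s j (ℕ.m⊔n≤o⇒m≤o N M le₂))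
      (hM i j (ℕ.m⊔n≤o⇒n≤o N M le₁) (ℕ.m⊔n≤o⇒n≤o N M le₂))
    where
    open ℚ.≤-Reasoning
    close : ∀ a b → c ℚ.≤ a → c ℚ.≤ b → ℚ.∣ a ℚ.- b ∣ ℚ.≤ δ ℚ.* (c ℚ.* c) → ℚ.∣ recip a ℚ.- recip b ∣ ℚ.≤ δ
    close a b c≤a c≤b d = begin
      ℚ.∣ a⁻¹ ℚ.- b⁻¹ ∣                           ≡⟨ cong ℚ.∣_∣ diff ⟩
      ℚ.∣ (a⁻¹ ℚ.* b⁻¹) ℚ.* (b ℚ.- a) ∣           ≡⟨ ℚ.∣p*q∣≡∣p∣*∣q∣ (a⁻¹ ℚ.* b⁻¹) (b ℚ.- a) ⟩
      ℚ.∣ a⁻¹ ℚ.* b⁻¹ ∣ ℚ.* ℚ.∣ b ℚ.- a ∣         ≡⟨ cong₂ ℚ._*_ (ℚ.0≤p⇒∣p∣≡p 0≤ab⁻¹) (∣sub∣-comm b a) ⟩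
      (a⁻¹ ℚ.* b⁻¹) ℚ.* ℚ.∣ a ℚ.- b ∣             ≤⟨ *-sub (a⁻¹ ℚ.* b⁻¹) 0≤ab⁻¹ (ℚ.≤-trans d (*-sub δ (ℚ.<⇒≤ 0<δ) (*-mono (ℚ.<⇒≤ 0<c) (ℚ.<⇒≤ 0<b) c≤a c≤b))) ⟩
      (a⁻¹ ℚ.* b⁻¹) ℚ.* (δ ℚ.* (a ℚ.* b))         ≡⟨ solve 5 (λ a a′ b b′ d → (a′ :* b′) :* (d :* (a :* b)) := ((a :* a′) :* (b :* b′)) :* d) refl a a⁻¹ b b⁻¹ δ ⟩
      ((a ℚ.* a⁻¹) ℚ.* (b ℚ.* b⁻¹)) ℚ.* δ         ≡⟨ cong₂ (λ u v → (u ℚ.* v) ℚ.* δ) aa⁻¹ bb⁻¹ ⟩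
      (1ℚ ℚ.* 1ℚ) ℚ.* δ                           ≡⟨ solve 1 (λ d → (con 1ℚ :* con 1ℚ) :* d := d) refl δ ⟩
      δ                                           ∎
      where
      a⁻¹ = recip a
      b⁻¹ = recip b
      0<a = ℚ.<-≤-trans 0<c c≤a
      0<b = ℚ.<-≤-trans 0<c c≤b
      aa⁻¹ = recip-inverse a 0<a
      bb⁻¹ = recip-inverse b 0<b
      0≤ab⁻¹ = ℚ.<⇒≤ (*-pos (recip-pos a 0<a) (recip-pos b 0<b))
      diff : a⁻¹ ℚ.- b⁻¹ ≡ (a⁻¹ ℚ.* b⁻¹) ℚ.* (b ℚ.- a)
      diff = begin-equality
        a⁻¹ ℚ.- b⁻¹                                       ≡⟨ solve 2 (λ x y → x :- y := x :* con 1ℚ :- y :* con 1ℚ) refl a⁻¹ b⁻¹ ⟩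
        a⁻¹ ℚ.* 1ℚ ℚ.- b⁻¹ ℚ.* 1ℚ                         ≡⟨ cong₂ (λ u v → a⁻¹ ℚ.* u ℚ.- b⁻¹ ℚ.* v) (sym bb⁻¹) (sym aa⁻¹) ⟩
        a⁻¹ ℚ.* (b ℚ.* b⁻¹) ℚ.- b⁻¹ ℚ.* (a ℚ.* a⁻¹)       ≡⟨ solve 4 (λ a a′ b b′ → a′ :* (b :* b′) :- b′ :* (a :* a′) := (a′ :* b′) :* (b :- a)) refl a a⁻¹ b b⁻¹ ⟩
        (a⁻¹ ℚ.* b⁻¹) ℚ.* (b ℚ.- a)                       ∎

open RealLemmas

fromℚ : ℚ → ℝ
fromℚ q = mkℝ (λ _ → q) (const-cauchy q)

fromℕ : ℕ → ℝ
fromℕ n = fromℚ (+ n ℚ./ 1)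

0ℝ : ℝ
0ℝ = fromℚ 0ℚ

infixl 6 _+_
infixl 7 _*_
infix  7 _÷_[_]
infixr 8 _^_

_+_ : ℝ → ℝ → ℝ
x + y = mkℝ (λ i → seq x i ℚ.+ seq y i) (+-cauchy {seq x} {seq y} (cauchy x) (cauchy y))

_*_ : ℝ → ℝ → ℝ
x * y = mkℝ (λ i → seq x i ℚ.* seq y i) (*-cauchy {seq x} {seq y} (cauchy x) (cauchy y))

_^_ : ℝ → ℕ → ℝ
x ^ zero  = fromℚ 1ℚ
x ^ suc k = x * x ^ k

reciprocal : (y : ℝ) → 0ℝ < y → ℝ
reciprocal y y>0 = mkℝ (λ i → recip (seq y i))
  (recip-cauchy {seq y} (gap y>0) (from y>0) (gap>0 y>0)
    (λ i le → subst (ℚ._≤ seq y i) (ℚ.+-identityˡ (gap y>0)) (spaced y>0 i le))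
    (cauchy y))

_÷_[_] : ℝ → (y : ℝ) → 0ℝ < y → ℝ
x ÷ y [ y>0 ] = x * reciprocal y y>0

infixr 8 _^ℚ_

_^ℚ_ : ℚ → ℕ → ℚ
q ^ℚ zero  = 1ℚ
q ^ℚ suc k = q ℚ.* q ^ℚ k

-- mercator q m = Σ_{k=1}^{m} q^k / k, whose limit for 0 ≤ q < 1 is - log (1 - q).
mercator : ℚ → ℕ → ℚ
mercator q zero    = 0ℚ
mercator q (suc m) = mercator q m ℚ.+ q ^ℚ suc m ℚ.* (+ 1 ℚ./ suc m)

module LogLemmas where

  open +-*-Solver using (solve; con; _:=_; _:+_; _:*_; _:-_)

  unit : ℕ → ℚ
  unit k = + 1 ℚ./ suc k

  unit-normal : ∀ k → unit k ≡ mkℚ (+ 1) k (1-coprimeTo (suc k))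
  unit-normal k = ℚ.normalize-coprime (1-coprimeTo (suc k))

  unit-antitone : ∀ {k m} → k ℕ.≤ m → unit m ℚ.≤ unit k
  unit-antitone {k} {m} k≤m = subst₂ ℚ._≤_ (sym (unit-normal m)) (sym (unit-normal k))
    (*≤* (subst₂ ℤ._≤_ (sym (ℤ.*-identityˡ (+ suc k))) (sym (ℤ.*-identityˡ (+ suc m))) (+≤+ (s≤s k≤m))))

  unit>0 : ∀ k → 0ℚ ℚ.< unit k
  unit>0 k = subst (0ℚ ℚ.<_) (sym (unit-normal k)) (ℚ.positive⁻¹ (mkℚ (+ 1) k (1-coprimeTo (suc k))))

  archimedes : ∀ δ → 0ℚ ℚ.< δ → ∃[ k ] unit k ℚ.≤ δ
  archimedes (mkℚ +[1+ a ] d c) _ = d , subst (ℚ._≤ mkℚ +[1+ a ] d c) (sym (unit-normal d))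
    (*≤* (ℤ.*-monoʳ-≤-nonNeg (+ suc d) (+≤+ {1} {suc a} (s≤s z≤n))))
  archimedes (mkℚ (+ 0) d c) (ℚ.*<* (+<+ ()))
  archimedes (mkℚ -[1+ a ] d c) (ℚ.*<* ())

  module Series (q : ℚ) (0≤q : 0ℚ ℚ.≤ q) (0<1-q : 0ℚ ℚ.< 1ℚ ℚ.- q) where
    open ℚ.≤-Reasoning

    S : ℕ → ℚ
    S = mercator q

    power≥0 : ∀ k → 0ℚ ℚ.≤ q ^ℚ k
    power≥0 zero    = ℚ.<⇒≤ (ℚ.positive⁻¹ 1ℚ)
    power≥0 (suc k) = *-nonNeg 0≤q (power≥0 k)

    q≤1 : q ℚ.≤ 1ℚ
    q≤1 = subst₂ ℚ._≤_ (ℚ.+-identityˡ q) (solve 1 (λ q → (con 1ℚ :- q) :+ q := con 1ℚ) refl q) (ℚ.+-monoˡ-≤ q (ℚ.<⇒≤ 0<1-q))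

    power≤1 : ∀ k → q ^ℚ k ℚ.≤ 1ℚ
    power≤1 zero    = ℚ.≤-refl
    power≤1 (suc k) = *-mono 0≤q (ℚ.<⇒≤ (ℚ.positive⁻¹ 1ℚ)) q≤1 (power≤1 k)

    step : ∀ m → S m ℚ.≤ S (suc m)
    step m = subst (ℚ._≤ S (suc m)) (ℚ.+-identityʳ (S m))
      (ℚ.+-monoʳ-≤ (S m) (*-nonNeg (power≥0 (suc m)) (ℚ.<⇒≤ (unit>0 m))))

    mono′ : ∀ {k m} → k ℕ.≤′ m → S k ℚ.≤ S m
    mono′ ℕ.≤′-refl       = ℚ.≤-refl
    mono′ (ℕ.≤′-step {m} k≤m) = ℚ.≤-trans (mono′ k≤m) (step m)

    mono : ∀ {k m} → k ℕ.≤ m → S k ℚ.≤ S m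
    mono k≤m = mono′ (ℕ.≤⇒≤′ k≤m)

    Φ : ℕ → ℕ → ℚ
    Φ k m = (1ℚ ℚ.- q) ℚ.* S m ℚ.+ unit k ℚ.* q ^ℚ suc m

    Φ-step : ∀ {k m} → k ℕ.≤ m → Φ k (suc m) ℚ.≤ Φ k m
    Φ-step {k} {m} k≤m = begin
      (1ℚ ℚ.- q) ℚ.* (S m ℚ.+ p ℚ.* unit m) ℚ.+ unit k ℚ.* (q ℚ.* p)
        ≤⟨ ℚ.+-monoˡ-≤ (unit k ℚ.* (q ℚ.* p)) (*-sub (1ℚ ℚ.- q) (ℚ.<⇒≤ 0<1-q) (ℚ.+-monoʳ-≤ (S m) (*-sub p (power≥0 (suc m)) (unit-antitone k≤m)))) ⟩
      (1ℚ ℚ.- q) ℚ.* (S m ℚ.+ p ℚ.* unit k) ℚ.+ unit k ℚ.* (q ℚ.* p)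
        ≡⟨ solve 4 (λ q s p u → (con 1ℚ :- q) :* (s :+ p :* u) :+ u :* (q :* p) := (con 1ℚ :- q) :* s :+ u :* p) refl q (S m) p (unit k) ⟩
      (1ℚ ℚ.- q) ℚ.* S m ℚ.+ unit k ℚ.* p ∎
      where p = q ^ℚ suc m

    Φ-anti : ∀ {k m} → k ℕ.≤′ m → Φ k m ℚ.≤ Φ k k
    Φ-anti ℕ.≤′-refl       = ℚ.≤-refl
    Φ-anti (ℕ.≤′-step k≤m) = ℚ.≤-trans (Φ-step (ℕ.≤′⇒≤ k≤m)) (Φ-anti k≤m)

    tail : ∀ {k m} → k ℕ.≤ m → (1ℚ ℚ.- q) ℚ.* (S m ℚ.- S k) ℚ.≤ unit k
    tail {k} {m} k≤m = begin
      r ℚ.* (S m ℚ.- S k)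
        ≡⟨ solve 4 (λ r a b c → r :* (a :- b) := r :* a :+ con 0ℚ :- r :* b) refl r (S m) (S k) 0ℚ ⟩
      r ℚ.* S m ℚ.+ 0ℚ ℚ.- r ℚ.* S k
        ≤⟨ ℚ.+-monoˡ-≤ (ℚ.- (r ℚ.* S k)) (ℚ.≤-trans (ℚ.+-monoʳ-≤ (r ℚ.* S m) (*-nonNeg (ℚ.<⇒≤ (unit>0 k)) (power≥0 (suc m)))) (Φ-anti (ℕ.≤⇒≤′ k≤m))) ⟩
      r ℚ.* S k ℚ.+ unit k ℚ.* q ^ℚ suc k ℚ.- r ℚ.* S k
        ≡⟨ solve 2 (λ a b → a :+ b :- a := b) refl (r ℚ.* S k) (unit k ℚ.* q ^ℚ suc k) ⟩
      unit k ℚ.* q ^ℚ suc k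
        ≤⟨ *-sub (unit k) (ℚ.<⇒≤ (unit>0 k)) (power≤1 (suc k)) ⟩
      unit k ℚ.* 1ℚ
        ≡⟨ ℚ.*-identityʳ (unit k) ⟩
      unit k ∎
      where r = 1ℚ ℚ.- q

    S-cauchy : Cauchy S
    S-cauchy δ 0<δ with archimedes ((1ℚ ℚ.- q) ℚ.* δ) (*-pos 0<1-q 0<δ)
    ... | N , hN = N , close
      where
      ordered : ∀ {i j} → N ℕ.≤ i → i ℕ.≤ j → ℚ.∣ S j ℚ.- S i ∣ ℚ.≤ δ
      ordered {i} {j} N≤i i≤j = subst (ℚ._≤ δ) (sym (ℚ.0≤p⇒∣p∣≡p 0≤d))
        (ℚ.*-cancelˡ-≤-pos (1ℚ ℚ.- q) {{ℚ.positive 0<1-q}} (ℚ.≤-trans (tail i≤j) (ℚ.≤-trans (unit-antitone N≤i) hN)))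
        where
        0≤d : 0ℚ ℚ.≤ S j ℚ.- S i
        0≤d = subst (ℚ._≤ S j ℚ.- S i) (ℚ.+-inverseʳ (S i)) (ℚ.+-monoˡ-≤ (ℚ.- S i) (mono i≤j))
      close : ∀ i j → N ℕ.≤ i → N ℕ.≤ j → ℚ.∣ S i ℚ.- S j ∣ ℚ.≤ δ
      close i j N≤i N≤j with ℕ.≤-total i j
      ... | inj₁ i≤j = subst (ℚ._≤ δ) (∣sub∣-comm (S j) (S i)) (ordered N≤i i≤j)
      ... | inj₂ j≤i = ordered N≤j j≤i

  1-1/n : ℕ → ℚ
  1-1/n k = 1ℚ ℚ.- unit k

  1-1/n≥0 : ∀ k → 0ℚ ℚ.≤ 1-1/n k
  1-1/n≥0 k = subst (ℚ._≤ 1-1/n k) (ℚ.+-inverseʳ (unit k)) (ℚ.+-monoˡ-≤ (ℚ.- unit k) (unit-antitone {0} {k} z≤n))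

  1-q>0 : ∀ k → 0ℚ ℚ.< 1ℚ ℚ.- 1-1/n k
  1-q>0 k = subst (0ℚ ℚ.<_) (solve 1 (λ u → u := con 1ℚ :- (con 1ℚ :- u)) refl (unit k)) (unit>0 k)

open LogLemmas

-- Natural logarithm: log n = - log (1 - q) with q = 1 - 1/n; the value at 0 is a convention.
log : ℕ → ℝ
log zero    = 0ℝ
log (suc k) = mkℝ (mercator (1ℚ ℚ.- + 1 ℚ./ suc k)) (Series.S-cauchy (1-1/n k) (1-1/n≥0 k) (1-q>0 k))

log>0 : ∀ n → .{{NonTrivial n}} → 0ℝ < log n
log>0 (suc (suc k)) = mk< (S 1) S1>0 1 λ i 1≤i → subst (ℚ._≤ S i) (sym (ℚ.+-identityˡ (S 1))) (mono 1≤i)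
  where
  open +-*-Solver using (solve; con; _:=_; _:+_; _:*_)
  open Series (1-1/n (suc k)) (1-1/n≥0 (suc k)) (1-q>0 (suc k))
  q = 1-1/n (suc k)
  0<q : 0ℚ ℚ.< q
  0<q = ℚ.<-≤-trans 0<½ (ℚ.+-monoʳ-≤ 1ℚ (ℚ.neg-antimono-≤ (unit-antitone {1} {suc k} (s≤s z≤n))))
  S1>0 : 0ℚ ℚ.< S 1
  S1>0 = subst (0ℚ ℚ.<_) (solve 1 (λ q → q := con 0ℚ :+ (q :* con 1ℚ) :* con 1ℚ) refl q) 0<q

-- Class sizes m and n; the vertex set is Fin m ⊎ Fin n, and edges join
-- inj₁ a to inj₂ b only, so the graph is simple and bipartite.
record BipartiteGraph (m n : ℕ) : Set where
  constructor mkBipartite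
  field
    edge : Fin m → Fin n → Bool

open BipartiteGraph public

module _ {m n : ℕ} where

  Adjacent : BipartiteGraph m n → Fin m → Fin n → Set
  Adjacent G a b = edge G a b ≡ true

  degree : BipartiteGraph m n → Fin m ⊎ Fin n → ℕ
  degree G (inj₁ a) = ∣ tabulate (λ b → edge G a b) ∣
  degree G (inj₂ b) = ∣ tabulate (λ a → edge G a b) ∣

  -- Subgraphs on the full vertex set; these suffice for embeddings that map
  -- classes onto classes.
  _IsSubgraphOf_ : BipartiteGraph m n → BipartiteGraph m n → Set
  G′ IsSubgraphOf G = ∀ a b → Adjacent G′ a b → Adjacent G a b

  _≅_ : BipartiteGraph m n → BipartiteGraph m n → Set
  H ≅ G = Σ[ σ ∈ Permutation m m ] Σ[ τ ∈ Permutation n n ]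
    (∀ s t → edge H s t ≡ edge G (σ ⟨$⟩ʳ s) (τ ⟨$⟩ʳ t))

  _EmbedsInto_ : BipartiteGraph m n → BipartiteGraph m n → Set
  H EmbedsInto G = ∃[ G′ ] (G′ IsSubgraphOf G × H ≅ G′)

{-# OPTIONS --safe #-}
module Submission where

-- H is a disjoint union of stars with centres s ∈ S of degrees d s summing to n.  Place the centres
-- on A by a random bijection σ.  By an exponential moment bound, every b ∈ B is with high
-- probability adjacent to centres of total degree at least n/2.  The moment is the permanent of a
-- matrix with two values per row, and it exceeds the moment for independent placements by a factor
-- of at most n + 1, since the central term of a binomial expansion is the largest; derandomising
-- along the rows gives an actual σ.  Join a leaf t to b when the image of the centre of t is
-- adjacent to b in G.  This n × n bipartite graph has row degrees > n/2 and column degrees ≥ n/2,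
-- so it has a perfect matching, which places the leaves.

-- Why n / log n: let the integer e stand for about 1/ε. Every b is adjacent to at least a fraction
-- ½ + 1/e of A, so the expected total degree of the centres placed next to b exceeds n/2 by at
-- least n/e. If all stars have degree at most D, the exponential moment bounds the probability of
-- losing this surplus by roughly exp(-n/(e² D)), up to constants in the exponent, and this has to
-- beat a union bound over the n choices of b. Everything is carried out in ℕ with denominators
-- cleared. The base of the exponential is (M + 1)/M for a single integer M under two opposite
-- demands: M ≥ (e + 1) D, so that one star changes the moment by a factor of at most 1 + 1/e and
-- first-order terms dominate; and M small enough that ((M + 1)/M)^n exceeds (n (n + 1))^e. Here n
-- pays for the union bound, n + 1 for placing without replacement, and the exponent e appears
-- because the mean of a row is estimated through its e-th power.

-- Finite sums, averaging and pigeonhole.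

module FiniteSums where

  open import Data.Bool.Base using (Bool; true; false)
  open import Data.Fin.Base using (Fin; zero; suc)
  open import Data.Fin.Properties using (any?)
  open import Data.Fin.Subset using (∣_∣)
  open import Data.Nat.Base
  open import Data.Nat.Properties
  open import Data.Product.Base using (∃-syntax; _×_; _,_)
  open import Data.Vec.Base using (tabulate)
  open import Function.Base using (_∘_)
  open import Relation.Binary.PropositionalEquality
  open import Relation.Nullary using (yes; no; contradiction)
  open import Algebra.Properties.Semiring.Sum +-*-semiring public
    using (sum; sum-cong-≗; sum-remove; sum-permute; ∑-comm; ∑-distrib-+; *-distribˡ-sum; *-distribʳ-sum)

  bit : Bool → ℕ
  bit true  = 1
  bit false = 0

  count : ∀ {n} → (Fin n → Bool) → ℕ
  count f = sum (bit ∘ f)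

  ∣tabulate∣≡count : ∀ {n} (f : Fin n → Bool) → ∣ tabulate f ∣ ≡ count f
  ∣tabulate∣≡count {zero}  f = refl
  ∣tabulate∣≡count {suc n} f with f zero
  ... | true  = cong suc (∣tabulate∣≡count (f ∘ suc))
  ... | false = ∣tabulate∣≡count (f ∘ suc)

  sum-mono-≤ : ∀ {n} {f g : Fin n → ℕ} → (∀ i → f i ≤ g i) → sum f ≤ sum g
  sum-mono-≤ {zero}  f≤g = z≤n
  sum-mono-≤ {suc n} f≤g = +-mono-≤ (f≤g zero) (sum-mono-≤ (f≤g ∘ suc))

  sum-mono-< : ∀ {n} {f g : Fin n → ℕ} → (∀ i → f i ≤ g i) → ∀ i → f i < g i → sum f < sum g
  sum-mono-< f≤g zero    f<g = +-mono-<-≤ f<g (sum-mono-≤ (f≤g ∘ suc))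
  sum-mono-< f≤g (suc i) f<g = +-mono-≤-< (f≤g zero) (sum-mono-< (f≤g ∘ suc) i f<g)

  sum-const : ∀ n x → sum {n} (λ _ → x) ≡ n * x
  sum-const zero    x = refl
  sum-const (suc n) x = cong (x +_) (sum-const n x)

  sum-ones : ∀ n → sum {n} (λ _ → 1) ≡ n
  sum-ones n = trans (sum-const n 1) (*-identityʳ n)

  term≤sum : ∀ {n} (f : Fin n → ℕ) i → f i ≤ sum f
  term≤sum f zero    = m≤m+n _ _
  term≤sum f (suc i) = ≤-trans (term≤sum (f ∘ suc) i) (m≤n+m _ _)

  sum<⇒∃< : ∀ {n} (f g : Fin n → ℕ) → sum f < sum g → ∃[ i ] f i < g i
  sum<⇒∃< f g lt with any? (λ i → f i <? g i)
  ... | yes p = p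
  ... | no ¬p = contradiction lt (≤⇒≯ (sum-mono-≤ λ i → ≮⇒≥ λ f<g → ¬p (i , f<g)))

  0<count⇒∃ : ∀ {n} (f : Fin n → Bool) → 0 < count f → ∃[ i ] f i ≡ true
  0<count⇒∃ {suc n} f lt with f zero in eq
  ... | true  = zero , eq
  ... | false with 0<count⇒∃ (f ∘ suc) lt
  ...   | i , fi = suc i , fi

  ∃-average : ∀ {n} (f : Fin (suc n) → ℕ) → ∃[ i ] suc n * f i ≤ sum f
  ∃-average {n} f with any? (λ i → suc n * f i ≤? sum f)
  ... | yes p = p
  ... | no ¬p = contradiction (sum-mono-< (λ i → <⇒≤ (big i)) zero (big zero)) (≤⇒≯ (≤-reflexive (trans (sym (*-distribˡ-sum (suc n) f)) (sym (sum-const (suc n) (sum f))))))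
    where
    big : ∀ i → sum f < suc n * f i
    big i = ≰⇒> λ le → ¬p (i , le)

  ∃-maximum : ∀ {n} (f : Fin n → ℕ) → Fin n → ∃[ i ] sum f ≤ n * f i
  ∃-maximum {n} f i₀ with any? (λ i → sum f ≤? n * f i)
  ... | yes p = p
  ... | no ¬p = contradiction (sum-mono-< (λ i → <⇒≤ (small i)) i₀ (small i₀)) (≤⇒≯ (≤-reflexive (trans (sum-const n (sum f)) (*-distribˡ-sum n f))))
    where
    small : ∀ i → n * f i < sum f
    small i = ≰⇒> λ le → ¬p (i , le)

  bits-overlap : ∀ x y → 1 < bit x + bit y → x ≡ true × y ≡ true
  bits-overlap true  true  _        = refl , refl
  bits-overlap true  false (s≤s ())
  bits-overlap false true  (s≤s ())

  counts-overlap : ∀ {n} (f g : Fin n → Bool) → n < count f + count g → ∃[ i ] f i ≡ true × g i ≡ true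
  counts-overlap {n} f g lt with sum<⇒∃< (λ _ → 1) (λ i → bit (f i) + bit (g i))
    (subst₂ _<_ (sym (sum-ones n)) (sym (∑-distrib-+ (bit ∘ f) (bit ∘ g))) lt)
  ... | i , p = i , bits-overlap (f i) (g i) p

-- Perfect matchings from degrees, by exchanges.

module Matching where

  open import Data.Bool.Base using (Bool; true; false)
  open import Data.Bool.Properties using () renaming (_≟_ to _≟ᵇ_)
  open import Data.Fin.Base using (Fin)
  open import Data.Fin.Permutation using (Permutation; _⟨$⟩ʳ_; transpose; _∘ₚ_; id)
  import Data.Fin.Permutation.Components as PC
  open import Data.Fin.Properties using (any?; _≟_)
  open import Data.Nat.Base
  open import Data.Nat.Properties hiding (_≟_)
  open import Data.Product.Base using (∃-syntax; _×_; _,_)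
  open import Function.Base using (_∘_)
  open import Relation.Binary.PropositionalEquality
  open import Relation.Nullary using (yes; no; ¬?; contradiction; decidable-stable)
  open FiniteSums

  bit≤1 : ∀ x → bit x ≤ 1
  bit≤1 true  = ≤-refl
  bit≤1 false = z≤n

  -- If row t is unmatched by τ, then the degree conditions give a row t′ such that exchanging
  -- the values of τ at t and t′ satisfies both rows, so the number of matched rows can be increased.
  perfect-matching : ∀ {n} (K : Fin n → Fin n → Bool) →
    (∀ t → n < 2 * count (K t)) → (∀ b → n ≤ 2 * count (λ t → K t b)) →
    ∃[ τ ] ∀ t → K t (τ ⟨$⟩ʳ t) ≡ true
  perfect-matching {n} K rows cols = search n id (m≤m+n n _)
    where
    matched : Permutation n n → ℕ
    matched τ = count (λ t → K t (τ ⟨$⟩ʳ t))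

    matched≤n : ∀ τ → matched τ ≤ n
    matched≤n τ = subst (matched τ ≤_) (sum-ones n) (sum-mono-≤ λ t → bit≤1 (K t (τ ⟨$⟩ʳ t)))

    exchange : ∀ τ t → ∃[ t′ ] K t (τ ⟨$⟩ʳ t′) ≡ true × K t′ (τ ⟨$⟩ʳ t) ≡ true
    exchange τ t = counts-overlap (λ t′ → K t (τ ⟨$⟩ʳ t′)) (λ t′ → K t′ (τ ⟨$⟩ʳ t))
      (*-cancelˡ-< 2 _ _ (begin-strict
        2 * n         ≡⟨ cong (n +_) (+-identityʳ n) ⟩
        n + n         <⟨ +-mono-<-≤ (rows t) (cols (τ ⟨$⟩ʳ t)) ⟩
        2 * count (K t) + 2 * c ≡⟨ sym (*-distribˡ-+ 2 (count (K t)) c) ⟩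
        -- Reindexing the row of t along τ makes both counts run over the same index t′, so that
        -- pigeonhole applies.
        2 * (count (K t) + c)   ≡⟨ cong (λ x → 2 * (x + c)) (sum-permute (bit ∘ K t) τ) ⟩
        2 * (count (λ t′ → K t (τ ⟨$⟩ʳ t′)) + c) ∎))
      where
      open ≤-Reasoning
      c = count (λ t′ → K t′ (τ ⟨$⟩ʳ t))

    improve : ∀ τ t → K t (τ ⟨$⟩ʳ t) ≢ true → ∃[ τ′ ] matched τ < matched τ′
    improve τ t bad with exchange τ t
    ... | t′ , good , good′ = transpose t t′ ∘ₚ τ , sum-mono-< mono t strict
      where
      mono : ∀ i → bit (K i (τ ⟨$⟩ʳ i)) ≤ bit (K i (τ ⟨$⟩ʳ PC.transpose t t′ i))
      mono i with i ≟ t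
      ... | yes refl rewrite good = bit≤1 (K i (τ ⟨$⟩ʳ i))
      ... | no _ with i ≟ t′
      ...   | yes refl rewrite good′ = bit≤1 (K i (τ ⟨$⟩ʳ i))
      ...   | no _ = ≤-refl
      strict : bit (K t (τ ⟨$⟩ʳ t)) < bit (K t (τ ⟨$⟩ʳ PC.transpose t t′ t))
      strict with t ≟ t
      ... | no t≢t = contradiction refl t≢t
      ... | yes _ rewrite good with K t (τ ⟨$⟩ʳ t)
      ...   | true  = contradiction refl bad
      ...   | false = s≤s z≤n

    -- The fuel bounds the number of unmatched rows. Each exchange gains a matched row and spends
    -- one unit; with no fuel left, a further gain would push the number of matched rows above n.
    search : ∀ fuel τ → n ≤ fuel + matched τ → ∃[ τ′ ] ∀ t → K t (τ′ ⟨$⟩ʳ t) ≡ true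
    search fuel τ bound with any? (λ t → ¬? (K t (τ ⟨$⟩ʳ t) ≟ᵇ true))
    ... | no all = τ , λ t → decidable-stable (K t (τ ⟨$⟩ʳ t) ≟ᵇ true) λ bad → all (t , bad)
    ... | yes (t , bad) with improve τ t bad
    search zero       τ bound | yes _ | τ′ , lt = contradiction (≤-<-trans bound lt) (≤⇒≯ (matched≤n τ′))
    search (suc fuel) τ bound | yes _ | τ′ , lt = search fuel τ′
      (≤-trans bound (≤-trans (≤-reflexive (sym (+-suc fuel (matched τ)))) (+-monoʳ-≤ fuel lt)))

-- Permanents of two-valued matrices, compared with independent choices.

module Permanents where

  open import Data.Bool.Base using (Bool; true; false; not; if_then_else_)
  open import Data.Fin.Base using (Fin; zero; suc; toℕ; punchIn)
  open import Data.Fin.Permutation using (_⟨$⟩ʳ_; insert; insert-punchIn; id)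
  open import Data.Fin.Properties using (toℕ≤pred[n])
  open import Data.Nat.Base
  open import Data.Nat.Combinatorics using (_C_; nCk≡n!/k![n-k]!; k![n∸k]!∣n!)
  open import Data.Nat.DivMod using (m/n*n≡m)
  open import Data.Nat.Properties
  open import Data.Nat.Tactic.RingSolver using (solve-∀)
  open import Data.Product.Base using (∃-syntax; _,_)
  open import Data.Sum.Base using (inj₁; inj₂)
  open import Function.Base using (_∘_)
  open import Relation.Binary.PropositionalEquality
  import Algebra.Properties.CommutativeSemiring.Binomial as Binomial
  open import Algebra.Properties.Semiring.Exp +-*-semiring using () renaming (_^_ to _^ˢ_)
  open import Algebra.Properties.Semiring.Mult +-*-semiring using (_×_)
  open import Algebra.Properties.CommutativeMonoid.Sum *-1-commutativeMonoid public using ()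
    renaming (sum to product; sum-cong-≗ to product-cong; ∑-distrib-+ to product-distrib-*)
  open FiniteSums

  product-mono-≤ : ∀ {n} {f g : Fin n → ℕ} → (∀ i → f i ≤ g i) → product f ≤ product g
  product-mono-≤ {zero}  f≤g = ≤-refl
  product-mono-≤ {suc n} f≤g = *-mono-≤ (f≤g zero) (product-mono-≤ (f≤g ∘ suc))

  minor : ∀ {r} → (Fin (suc r) → Fin (suc r) → ℕ) → Fin (suc r) → Fin r → Fin r → ℕ
  minor F a i c = F (suc i) (punchIn a c)

  permanent : ∀ {r} → (Fin r → Fin r → ℕ) → ℕ
  permanent {zero}  F = 1
  permanent {suc r} F = sum λ a → F zero a * permanent (minor F a)

  -- The right-hand side is the sum over all permutations π; expanding along the first row,
  -- the value π 0 is chosen so that the conditional average does not increase.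
  ∃-permutation-below-average : ∀ {m r} (c : Fin m → ℕ) (F : Fin m → Fin r → Fin r → ℕ) →
    ∃[ π ] r ! * sum (λ b → c b * product (λ i → F b i (π ⟨$⟩ʳ i))) ≤ sum (λ b → c b * permanent (F b))
  ∃-permutation-below-average {m} {zero}  c F = id , ≤-reflexive (*-identityˡ _)
  ∃-permutation-below-average {m} {suc r} c F =
    let a , a-below = ∃-average column
        -- Once the first row is sent to a, its entry is a constant for each b and is absorbed into
        -- the weight. The weights `c` make this induction possible.
        π , π-below = ∃-permutation-below-average (λ b → c b * F b zero a) (λ b → minor (F b) a)
    in insert zero a π , (begin
      suc r ! * sum (λ b → c b * product (λ i → F b i (insert zero a π ⟨$⟩ʳ i)))
        ≡⟨ cong (suc r ! *_) (sum-cong-≗ λ b → trans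
             (cong (λ x → c b * (F b zero a * x)) (product-cong λ i → cong (F b (suc i)) (insert-punchIn zero a π i)))
             (sym (*-assoc (c b) (F b zero a) _))) ⟩
      suc r ! * sum (λ b → c b * F b zero a * product (λ i → minor (F b) a i (π ⟨$⟩ʳ i)))
        ≡⟨ *-assoc (suc r) (r !) _ ⟩
      suc r * (r ! * sum (λ b → c b * F b zero a * product (λ i → minor (F b) a i (π ⟨$⟩ʳ i))))
        ≤⟨ *-monoʳ-≤ (suc r) π-below ⟩
      suc r * column a
        ≤⟨ a-below ⟩
      sum column
        ≡⟨ ∑-comm (λ a b → c b * F b zero a * permanent (minor (F b) a)) ⟩
      sum (λ b → sum λ a → c b * F b zero a * permanent (minor (F b) a))
        ≡⟨ sum-cong-≗ (λ b → trans (sum-cong-≗ λ a → *-assoc (c b) (F b zero a) (permanent (minor (F b) a)))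
             (sym (*-distribˡ-sum (c b) λ a → F b zero a * permanent (minor (F b) a)))) ⟩
      sum (λ b → c b * permanent (F b)) ∎)
    where
    open ≤-Reasoning
    column : Fin (suc r) → ℕ
    column a = sum λ b → c b * F b zero a * permanent (minor (F b) a)

  twoValued : ∀ {r} → (Fin r → Bool) → (u v : Fin r → ℕ) → Fin r → Fin r → ℕ
  twoValued N u v i a = if N a then u i else v i

  -- The value at n = 0 spares the row expansion a case distinction: if no column of one kind is
  -- left, its term vanishes.
  n*pred[n]!≤n! : ∀ n → n * pred n ! ≤ n !
  n*pred[n]!≤n! zero    = z≤n
  n*pred[n]!≤n! (suc n) = ≤-refl

  count-remove : ∀ {r} (N : Fin (suc r) → Bool) a → count N ≡ bit (N a) + count (N ∘ punchIn a)
  count-remove N a = sum-remove {i = a} (bit ∘ N)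

  -- Let k columns satisfy `N` and j not. With p and q read as indeterminates, the permanent is k!
  -- j! times the coefficient of p^k q^j in the product: that coefficient sums over the k-sets of
  -- rows sent to the marked columns. A single term of a polynomial with nonnegative coefficients is
  -- at most the whole value. The proof expands along the first row.
  permanent-twoValued : ∀ p q {r} (N : Fin r → Bool) (u v : Fin r → ℕ) →
    permanent (twoValued N u v) * (p ^ count N * q ^ count (not ∘ N)) ≤
    count N ! * count (not ∘ N) ! * product (λ i → p * u i + q * v i)
  permanent-twoValued p q {zero}  N u v = ≤-refl
  permanent-twoValued p q {suc r} N u v = begin
    permanent (twoValued N u v) * (p ^ k * q ^ j)
      ≡⟨ *-distribʳ-sum (p ^ k * q ^ j) (λ a → twoValued N u v zero a * permanent (minor (twoValued N u v) a)) ⟩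
    sum (λ a → twoValued N u v zero a * permanent (minor (twoValued N u v) a) * (p ^ k * q ^ j))
      ≤⟨ sum-mono-≤ entry ⟩
    sum (λ a → bit (N a) * X + bit (not (N a)) * Y)
      ≡⟨ trans (∑-distrib-+ (λ a → bit (N a) * X) (λ a → bit (not (N a)) * Y))
           (sym (cong₂ _+_ (*-distribʳ-sum X (bit ∘ N)) (*-distribʳ-sum Y (bit ∘ not ∘ N)))) ⟩
    k * X + j * Y
      ≡⟨ regroup k j p q (u zero) (v zero) (pred k !) (pred j !) (k !) (j !) Π ⟩
    p * u zero * (k * pred k ! * j ! * Π) + q * v zero * (k ! * (j * pred j !) * Π)
      ≤⟨ +-mono-≤
           (*-monoʳ-≤ (p * u zero) (*-monoˡ-≤ Π (*-monoˡ-≤ (j !) (n*pred[n]!≤n! k))))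
           (*-monoʳ-≤ (q * v zero) (*-monoˡ-≤ Π (*-monoʳ-≤ (k !) (n*pred[n]!≤n! j)))) ⟩
    p * u zero * (k ! * j ! * Π) + q * v zero * (k ! * j ! * Π)
      ≡⟨ factor (p * u zero) (q * v zero) (k ! * j !) Π ⟩
    k ! * j ! * ((p * u zero + q * v zero) * Π) ∎
    where
    open ≤-Reasoning
    k = count N
    j = count (not ∘ N)
    Π = product (λ i → p * u (suc i) + q * v (suc i))
    X = p * u zero * (pred k ! * j !) * Π
    Y = q * v zero * (k ! * pred j !) * Π

    regroup : ∀ k j p q u v k₁ j₁ k₀ j₀ Π →
      k * (p * u * (k₁ * j₀) * Π) + j * (q * v * (k₀ * j₁) * Π) ≡ p * u * (k * k₁ * j₀ * Π) + q * v * (k₀ * (j * j₁) * Π)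
    regroup = solve-∀

    factor : ∀ x y f Π → x * (f * Π) + y * (f * Π) ≡ f * ((x + y) * Π)
    factor = solve-∀

    inside : ∀ u P p pᵏ qʲ → u * P * (p * pᵏ * qʲ) ≡ p * u * (P * (pᵏ * qʲ))
    inside = solve-∀

    outside : ∀ v P q pᵏ qʲ → v * P * (pᵏ * (q * qʲ)) ≡ q * v * (P * (pᵏ * qʲ))
    outside = solve-∀

    entry : ∀ a → twoValued N u v zero a * permanent (minor (twoValued N u v) a) * (p ^ k * q ^ j) ≤ bit (N a) * X + bit (not (N a)) * Y
    entry a with N a | count-remove N a | count-remove (not ∘ N) a | permanent-twoValued p q (N ∘ punchIn a) (u ∘ suc) (v ∘ suc)
    ... | true | k≡ | j≡ | ih = begin
      u zero * P * (p ^ k * q ^ j)             ≡⟨ cong₂ (λ x y → u zero * P * (p ^ x * q ^ y)) k≡ j≡ ⟩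
      u zero * P * (p * p ^ k′ * q ^ j′)       ≡⟨ inside (u zero) P p (p ^ k′) (q ^ j′) ⟩
      p * u zero * (P * (p ^ k′ * q ^ j′))     ≤⟨ *-monoʳ-≤ (p * u zero) ih ⟩
      p * u zero * (k′ ! * j′ ! * Π)           ≡⟨ sym (*-assoc (p * u zero) (k′ ! * j′ !) Π) ⟩
      p * u zero * (k′ ! * j′ !) * Π           ≡⟨ cong₂ (λ x y → p * u zero * (pred x ! * y !) * Π) (sym k≡) (sym j≡) ⟩
      X                                        ≡⟨ sym (trans (+-identityʳ (1 * X)) (*-identityˡ X)) ⟩
      1 * X + 0 * Y ∎
      where
      P = permanent (minor (twoValued N u v) a)
      k′ = count (N ∘ punchIn a)
      j′ = count (not ∘ N ∘ punchIn a)
    ... | false | k≡ | j≡ | ih = begin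
      v zero * P * (p ^ k * q ^ j)             ≡⟨ cong₂ (λ x y → v zero * P * (p ^ x * q ^ y)) k≡ j≡ ⟩
      v zero * P * (p ^ k′ * (q * q ^ j′))     ≡⟨ outside (v zero) P q (p ^ k′) (q ^ j′) ⟩
      q * v zero * (P * (p ^ k′ * q ^ j′))     ≤⟨ *-monoʳ-≤ (q * v zero) ih ⟩
      q * v zero * (k′ ! * j′ ! * Π)           ≡⟨ sym (*-assoc (q * v zero) (k′ ! * j′ !) Π) ⟩
      q * v zero * (k′ ! * j′ !) * Π           ≡⟨ cong₂ (λ x y → q * v zero * (x ! * pred y !) * Π) (sym k≡) (sym j≡) ⟩
      Y                                        ≡⟨ sym (*-identityˡ Y) ⟩
      0 * X + 1 * Y ∎
      where
      P = permanent (minor (twoValued N u v) a)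
      k′ = count (N ∘ punchIn a)
      j′ = count (not ∘ N ∘ punchIn a)

  -- Each of the m factors of (i + m)! / i! is at most i + m.
  [i+m]!≤i!*[i+m]^m : ∀ i m → (i + m) ! ≤ i ! * (i + m) ^ m
  [i+m]!≤i!*[i+m]^m i zero    = ≤-reflexive (trans (cong _! (+-identityʳ i)) (sym (*-identityʳ (i !))))
  [i+m]!≤i!*[i+m]^m i (suc m) = begin
    (i + suc m) !                          ≡⟨ cong _! (+-suc i m) ⟩
    suc (i + m) * (i + m) !                ≤⟨ *-monoʳ-≤ (suc (i + m)) ([i+m]!≤i!*[i+m]^m i m) ⟩
    suc (i + m) * (i ! * (i + m) ^ m)      ≤⟨ *-monoʳ-≤ (suc (i + m)) (*-monoʳ-≤ (i !) (^-monoˡ-≤ m (n≤1+n (i + m)))) ⟩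
    suc (i + m) * (i ! * suc (i + m) ^ m)  ≡⟨ swap (suc (i + m)) (i !) (suc (i + m) ^ m) ⟩
    i ! * suc (i + m) ^ suc m              ≡⟨ cong (λ x → i ! * x ^ suc m) (sym (+-suc i m)) ⟩
    i ! * (i + suc m) ^ suc m              ∎
    where
    open ≤-Reasoning
    swap : ∀ x y z → x * (y * z) ≡ y * (x * z)
    swap = solve-∀

  k!*k^m≤[k+m]! : ∀ k m → k ! * k ^ m ≤ (k + m) !
  k!*k^m≤[k+m]! k zero    = ≤-reflexive (trans (*-identityʳ (k !)) (cong _! (sym (+-identityʳ k))))
  k!*k^m≤[k+m]! k (suc m) = begin
    k ! * (k * k ^ m)         ≡⟨ swap (k !) k (k ^ m) ⟩
    k * (k ! * k ^ m)         ≤⟨ *-mono-≤ (≤-trans (m≤m+n k m) (n≤1+n (k + m))) (k!*k^m≤[k+m]! k m) ⟩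
    suc (k + m) * (k + m) !   ≡⟨ cong _! (sym (+-suc k m)) ⟩
    (k + suc m) !             ∎
    where
    open ≤-Reasoning
    swap : ∀ x y z → x * (y * z) ≡ y * (x * z)
    swap = solve-∀

  -- The quotient k^i / i! is largest at i = k, since passing from i to i + 1 multiplies it by k /
  -- (i + 1).
  power-factorial : ∀ k i → k ^ i * k ! ≤ k ^ k * i !
  power-factorial k i with ≤-total i k
  ... | inj₁ i≤k with m≤n⇒∃[o]m+o≡n i≤k
  ...   | m , refl = begin
    (i + m) ^ i * (i + m) !                ≤⟨ *-monoʳ-≤ ((i + m) ^ i) ([i+m]!≤i!*[i+m]^m i m) ⟩
    (i + m) ^ i * (i ! * (i + m) ^ m)      ≡⟨ rotate ((i + m) ^ i) (i !) ((i + m) ^ m) ⟩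
    (i + m) ^ i * (i + m) ^ m * i !        ≡⟨ cong (_* i !) (sym (^-distribˡ-+-* (i + m) i m)) ⟩
    (i + m) ^ (i + m) * i !                ∎
    where
    open ≤-Reasoning
    rotate : ∀ x y z → x * (y * z) ≡ x * z * y
    rotate = solve-∀
  power-factorial k i | inj₂ k≤i with m≤n⇒∃[o]m+o≡n k≤i
  ...   | m , refl = begin
    k ^ (k + m) * k !         ≡⟨ cong (_* k !) (^-distribˡ-+-* k k m) ⟩
    k ^ k * k ^ m * k !       ≡⟨ rotate (k ^ k) (k ^ m) (k !) ⟩
    k ^ k * (k ! * k ^ m)     ≤⟨ *-monoʳ-≤ (k ^ k) (k!*k^m≤[k+m]! k m) ⟩
    k ^ k * (k + m) !         ∎
    where
    open ≤-Reasoning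
    rotate : ∀ x y z → x * y * z ≡ x * (z * y)
    rotate = solve-∀

  ^ˢ≡^ : ∀ x n → x ^ˢ n ≡ x ^ n
  ^ˢ≡^ x zero    = refl
  ^ˢ≡^ x (suc n) = cong (x *_) (^ˢ≡^ x n)

  ×≡* : ∀ n x → n × x ≡ n * x
  ×≡* zero    x = refl
  ×≡* (suc n) x = cong (x +_) (×≡* n x)

  binomial-theorem : ∀ n x y → (x + y) ^ n ≡ sum {suc n} (λ i → (n C toℕ i) * (x ^ toℕ i * y ^ (n ∸ toℕ i)))
  binomial-theorem n x y = trans (sym (^ˢ≡^ (x + y) n)) (trans (Binomial.theorem +-*-commutativeSemiring n x y)
    (sum-cong-≗ {suc n} λ i → trans (×≡* (n C toℕ i) _)
      (cong ((n C toℕ i) *_) (cong₂ _*_ (^ˢ≡^ x (toℕ i)) (^ˢ≡^ y (n ∸ toℕ i))))))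

  nCi*i!*[n∸i]!≡n! : ∀ {n i} → i ≤ n → (n C i) * (i ! * (n ∸ i) !) ≡ n !
  nCi*i!*[n∸i]!≡n! {n} {i} i≤n = trans (cong (_* (i ! * (n ∸ i) !)) (nCk≡n!/k![n-k]! i≤n))
    (m/n*n≡m {{i !* (n ∸ i) !≢0}} (k![n∸k]!∣n! i≤n))

  -- The term i = k of the binomial expansion of (k + j) ^ (k + j) is the largest.
  binomial-mode : ∀ k j → let n = k + j in n ^ n * (k ! * j !) ≤ suc n * (n ! * (k ^ k * j ^ j))
  binomial-mode k j = begin
    n ^ n * (k ! * j !)
      ≡⟨ cong (_* (k ! * j !)) (binomial-theorem n k j) ⟩
    sum {suc n} (λ i → (n C toℕ i) * (k ^ toℕ i * j ^ (n ∸ toℕ i))) * (k ! * j !)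
      ≡⟨ *-distribʳ-sum (k ! * j !) (λ (i : Fin (suc n)) → (n C toℕ i) * (k ^ toℕ i * j ^ (n ∸ toℕ i))) ⟩
    sum {suc n} (λ i → (n C toℕ i) * (k ^ toℕ i * j ^ (n ∸ toℕ i)) * (k ! * j !))
      ≤⟨ sum-mono-≤ {suc n} (λ i → term (toℕ i) (toℕ≤pred[n] i)) ⟩
    sum {suc n} (λ _ → n ! * (k ^ k * j ^ j))
      ≡⟨ sum-const (suc n) _ ⟩
    suc n * (n ! * (k ^ k * j ^ j)) ∎
    where
    open ≤-Reasoning
    n = k + j
    pair : ∀ c x y f g → c * (x * y) * (f * g) ≡ c * ((x * f) * (y * g))
    pair = solve-∀
    unpair : ∀ c x y f g → c * ((x * f) * (y * g)) ≡ c * (f * g) * (x * y)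
    unpair = solve-∀
    term : ∀ i → i ≤ n → (n C i) * (k ^ i * j ^ (n ∸ i)) * (k ! * j !) ≤ n ! * (k ^ k * j ^ j)
    term i i≤n = begin
      (n C i) * (k ^ i * j ^ (n ∸ i)) * (k ! * j !)      ≡⟨ pair (n C i) (k ^ i) (j ^ (n ∸ i)) (k !) (j !) ⟩
      -- The binomial term is n! times k^i / i! times j^(n-i) / (n-i)!; the two quotients are
      -- largest at i = k and n - i = j, which is the same i.
      (n C i) * ((k ^ i * k !) * (j ^ (n ∸ i) * j !))    ≤⟨ *-monoʳ-≤ (n C i) (*-mono-≤ (power-factorial k i) (power-factorial j (n ∸ i))) ⟩
      (n C i) * ((k ^ k * i !) * (j ^ j * (n ∸ i) !))    ≡⟨ unpair (n C i) (k ^ k) (j ^ j) (i !) ((n ∸ i) !) ⟩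
      (n C i) * (i ! * (n ∸ i) !) * (k ^ k * j ^ j)      ≡⟨ cong (_* (k ^ k * j ^ j)) (nCi*i!*[n∸i]!≡n! i≤n) ⟩
      n ! * (k ^ k * j ^ j)                              ∎

  -- Since 0 ^ 0 is 1, the factor k^k j^j in `permanent-bound` can be cancelled even when all or
  -- none of the columns are marked.
  n^n≢0 : ∀ n → NonZero (n ^ n)
  n^n≢0 zero    = _
  n^n≢0 (suc n) = m^n≢0 (suc n) (suc n)

  count+count-not : ∀ {n} (N : Fin n → Bool) → count N + count (not ∘ N) ≡ n
  count+count-not {n} N = trans (sym (∑-distrib-+ (bit ∘ N) (bit ∘ not ∘ N)))
    (trans (sum-cong-≗ λ i → bit+bit-not (N i)) (sum-ones n))
    where
    bit+bit-not : ∀ x → bit x + bit (not x) ≡ 1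
    bit+bit-not true  = refl
    bit+bit-not false = refl

  -- Up to the factor n + 1, choosing the columns without replacement is no worse than independently.
  permanent-bound : ∀ {n} (N : Fin n → Bool) (u v : Fin n → ℕ) →
    permanent (twoValued N u v) * n ^ n ≤ suc n * (n ! * product (λ i → count N * u i + count (not ∘ N) * v i))
  permanent-bound {n} N u v = *-cancelʳ-≤ _ _ (k ^ k * j ^ j) {{m*n≢0 (k ^ k) (j ^ j) {{n^n≢0 k}} {{n^n≢0 j}}}} (begin
    P * n ^ n * (k ^ k * j ^ j)                    ≡⟨ rotate P (n ^ n) (k ^ k * j ^ j) ⟩
    -- The values p = k and q = j are the proportions of an independent uniform choice of columns,
    -- for which the term p^k q^j is the dominant one.
    n ^ n * (P * (k ^ k * j ^ j))                  ≤⟨ *-monoʳ-≤ (n ^ n) (permanent-twoValued k j N u v) ⟩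
    n ^ n * (k ! * j ! * Π)                        ≡⟨ sym (*-assoc (n ^ n) (k ! * j !) Π) ⟩
    n ^ n * (k ! * j !) * Π                        ≤⟨ *-monoˡ-≤ Π (subst (λ x → x ^ x * (k ! * j !) ≤ suc x * (x ! * (k ^ k * j ^ j))) (count+count-not N) (binomial-mode k j)) ⟩
    suc n * (n ! * (k ^ k * j ^ j)) * Π            ≡⟨ rotate′ (suc n) (n !) (k ^ k * j ^ j) Π ⟩
    suc n * (n ! * Π) * (k ^ k * j ^ j)            ∎)
    where
    open ≤-Reasoning
    k = count N
    j = count (not ∘ N)
    P = permanent (twoValued N u v)
    Π = product (λ i → k * u i + j * v i)
    rotate : ∀ x y z → x * y * z ≡ y * (x * z)
    rotate = solve-∀
    rotate′ : ∀ w x y z → w * (x * y) * z ≡ w * (x * z) * y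
    rotate′ = solve-∀

-- The exponential moment and a balanced placement of the centres.

module Assignment where

  open import Data.Bool.Base using (Bool; true; false; not; if_then_else_)
  open import Data.Fin.Base using (Fin; zero; suc)
  open import Data.Fin.Permutation using (_⟨$⟩ʳ_)
  open import Data.Nat.Base
  open import Data.Nat.Properties
  open import Data.Nat.Tactic.RingSolver using (solve-∀)
  open import Data.Product.Base using (∃-syntax; _,_; proj₁; proj₂)
  open import Function.Base using (_∘_; it)
  open import Relation.Binary.PropositionalEquality
  open import Relation.Nullary using (yes; no; contradiction)
  open FiniteSums
  open Permanents

  ^-distribʳ-* : ∀ e x y → (x * y) ^ e ≡ x ^ e * y ^ e
  ^-distribʳ-* zero    x y = refl
  ^-distribʳ-* (suc e) x y = trans (cong (x * y *_) (^-distribʳ-* e x y)) ([m*n]*[o*p]≡[m*o]*[n*p] x y (x ^ e) (y ^ e))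

  product-^ : ∀ {n} e (f : Fin n → ℕ) → product (λ i → f i ^ e) ≡ product f ^ e
  product-^ {zero}  e f = sym (^-zeroˡ e)
  product-^ {suc n} e f = trans (cong (f zero ^ e *_) (product-^ e (f ∘ suc))) (sym (^-distribʳ-* e (f zero) (product (f ∘ suc))))

  product-^-sum : ∀ {n} x (d : Fin n → ℕ) → product (λ i → x ^ d i) ≡ x ^ sum d
  product-^-sum {zero}  x d = refl
  product-^-sum {suc n} x d = trans (cong (x ^ d zero *_) (product-^-sum x (d ∘ suc))) (sym (^-distribˡ-+-* x (d zero) (sum (d ∘ suc))))

  product-const : ∀ n x → product {n} (λ _ → x) ≡ x ^ n
  product-const zero    x = refl
  product-const (suc n) x = cong (x *_) (product-const n x)

  -- Bernoulli's inequality for (1 + x/a)^(m + 1), with denominators cleared.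
  bernoulli : ∀ a x m → a ^ m * (a + suc m * x) ≤ (a + x) ^ suc m
  bernoulli a x zero    = ≤-reflexive (base a x)
    where
    base : ∀ a x → 1 * (a + 1 * x) ≡ (a + x) * 1
    base = solve-∀
  bernoulli a x (suc m) = begin
    a ^ suc m * (a + suc (suc m) * x)                                 ≡⟨ split a (a ^ m) x m ⟩
    a * (a ^ m * (a + suc m * x)) + x * (a ^ m * a)                   ≤⟨ +-monoʳ-≤ _ (*-monoʳ-≤ x (*-monoʳ-≤ (a ^ m) (m≤m+n a (suc m * x)))) ⟩
    a * (a ^ m * (a + suc m * x)) + x * (a ^ m * (a + suc m * x))     ≡⟨ sym (*-distribʳ-+ (a ^ m * (a + suc m * x)) a x) ⟩
    (a + x) * (a ^ m * (a + suc m * x))                               ≤⟨ *-monoʳ-≤ (a + x) (bernoulli a x m) ⟩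
    (a + x) ^ suc (suc m)                                             ∎
    where
    open ≤-Reasoning
    split : ∀ a p x m → a * p * (a + (1 + (1 + m)) * x) ≡ a * (p * (a + (1 + m) * x)) + x * (p * a)
    split = solve-∀

  -- (1 - x/e)ᵉ (1 + x) ≤ 1 with x = X / U, by Bernoulli and (1 - x/e) (1 + x/e) ≤ 1.
  power-below : ∀ e U X Z .{{_ : NonZero e}} .{{_ : NonZero U}} → Z + X ≡ e * U → Z ^ e * (U + X) ≤ (e * U) ^ e * U
  power-below e@(suc m) U X Z eq = *-cancelʳ-≤ _ _ (a ^ m * e) {{m*n≢0 (a ^ m) e {{m^n≢0 a m {{m*n≢0 e U}}}}}} (begin
    Z ^ e * (U + X) * (a ^ m * e)   ≡⟨ gather (Z ^ e) U X (a ^ m) e ⟩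
    Z ^ e * (a ^ m * (a + e * X))   ≤⟨ *-monoʳ-≤ (Z ^ e) (bernoulli a X m) ⟩
    Z ^ e * (a + X) ^ e             ≡⟨ sym (^-distribʳ-* e Z (a + X)) ⟩
    (Z * (a + X)) ^ e               ≤⟨ ^-monoˡ-≤ e square ⟩
    (a * a) ^ e                     ≡⟨ ^-distribʳ-* e a a ⟩
    a ^ e * a ^ e                   ≡⟨ spread (a ^ e) e U (a ^ m) ⟩
    a ^ e * U * (a ^ m * e)         ∎)
    where
    open ≤-Reasoning
    a = e * U
    gather : ∀ z U X p e → z * (U + X) * (p * e) ≡ z * (p * (e * U + e * X))
    gather = solve-∀
    spread : ∀ z e U p → z * (e * U * p) ≡ z * U * (p * e)
    spread = solve-∀
    expand : ∀ Z X → (Z + X) * (Z + X) ≡ Z * (Z + X + X) + X * X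
    expand = solve-∀
    square : Z * (a + X) ≤ a * a
    square = subst (λ y → Z * (y + X) ≤ y * y) eq (≤-trans (m≤m+n _ (X * X)) (≤-reflexive (sym (expand Z X))))

  -- Put x = X / U and divide by e n U V, where V = U + X: the average of 1/(1 + x) over k columns
  -- and 1 + x over j columns is at most 1 - x/e. The assumption k - j ≥ 2n/e makes the linear term
  -- at most -2x/e, and half of it pays for the quadratic terms.
  mean-below : ∀ e k j U X Z .{{_ : NonZero e}} → 2 ≤ e → e * j + 2 * (k + j) ≤ e * k → e * X ≤ U → Z + X ≡ e * U →
    e * (k * (U * U) + j * ((U + X) * (U + X))) ≤ (k + j) * ((U + X) * Z)
  mean-below e k j U X Z 2≤e dense small eq = +-cancelʳ-≤ (n * (V * X)) _ _ (begin
    e * (k * (U * U) + j * (V * V)) + n * (V * X)                           ≡⟨ expand e k j U X ⟩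
    e * n * (U * U) + (X * (e * j * X + n * X) + (2 * (e * j) + n) * (U * X)) ≤⟨ +-monoʳ-≤ (e * n * (U * U)) (+-monoˡ-≤ ((2 * (e * j) + n) * (U * X)) (*-monoʳ-≤ X quadratic)) ⟩
    e * n * (U * U) + (X * (n * U) + (2 * (e * j) + n) * (U * X))           ≡⟨ collect e k j U X ⟩
    e * n * (U * U) + (e * j + (e * j + 2 * n)) * (U * X)                   ≤⟨ +-monoʳ-≤ (e * n * (U * U)) (*-monoˡ-≤ (U * X) (+-monoʳ-≤ (e * j) dense)) ⟩
    e * n * (U * U) + (e * j + e * k) * (U * X)                             ≡⟨ contract e k j U X ⟩
    n * (V * (e * U))                                                       ≡⟨ cong (λ y → n * (V * y)) (sym eq) ⟩
    n * (V * (Z + X))                                                       ≡⟨ distribute n V Z X ⟩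
    n * (V * Z) + n * (V * X)                                               ∎)
    where
    open ≤-Reasoning
    n = k + j
    V = U + X
    expand : ∀ e k j U X → e * (k * (U * U) + j * ((U + X) * (U + X))) + (k + j) * ((U + X) * X)
      ≡ e * (k + j) * (U * U) + (X * (e * j * X + (k + j) * X) + (2 * (e * j) + (k + j)) * (U * X))
    expand = solve-∀
    collect : ∀ e k j U X → e * (k + j) * (U * U) + (X * ((k + j) * U) + (2 * (e * j) + (k + j)) * (U * X))
      ≡ e * (k + j) * (U * U) + (e * j + (e * j + 2 * (k + j))) * (U * X)
    collect = solve-∀
    contract : ∀ e k j U X → e * (k + j) * (U * U) + (e * j + e * k) * (U * X) ≡ (k + j) * ((U + X) * (e * U))
    contract = solve-∀
    distribute : ∀ n V Z X → n * (V * (Z + X)) ≡ n * (V * Z) + n * (V * X)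
    distribute = solve-∀
    j≤k : j ≤ k
    j≤k = *-cancelˡ-≤ e (≤-trans (m≤m+n (e * j) _) dense)
    swap : ∀ e j X → e * j * X ≡ j * (e * X)
    swap = solve-∀
    double : ∀ k X → (k + k) * X ≡ k * (2 * X)
    double = solve-∀
    -- The quadratic terms fit because n ≤ 2k and 2X ≤ eX ≤ U, which is where `2≤e` enters.
    quadratic : e * j * X + n * X ≤ n * U
    quadratic = begin
      e * j * X + n * X      ≤⟨ +-monoʳ-≤ (e * j * X) (*-monoˡ-≤ X (+-monoʳ-≤ k j≤k)) ⟩
      e * j * X + (k + k) * X ≡⟨ cong₂ _+_ (swap e j X) (double k X) ⟩
      j * (e * X) + k * (2 * X) ≤⟨ +-mono-≤ (*-monoʳ-≤ j small) (*-monoʳ-≤ k (≤-trans (*-monoˡ-≤ X 2≤e) small)) ⟩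
      j * U + k * U          ≡⟨ trans (+-comm (j * U) (k * U)) (sym (*-distribʳ-+ U k j)) ⟩
      n * U                  ∎

  -- The e-th power turns the bound 1 - x/e on the normalised mean into 1/(1 + x) = U / V. For U =
  -- M^d and V = (M + 1)^d these ratios multiply over the rows to a quantity depending only on the
  -- sum of the degrees.
  factor-bound : ∀ e k j U V .{{_ : NonZero e}} .{{_ : NonZero U}} → 2 ≤ e → e * j + 2 * (k + j) ≤ e * k → U ≤ V → e * V ≤ suc e * U →
    (k * (U * U) + j * (V * V)) ^ e * V ≤ ((k + j) * (U * V)) ^ e * U
  factor-bound e k j U V 2≤e dense U≤V small with m≤n⇒∃[o]m+o≡n U≤V
  ... | X , refl = *-cancelʳ-≤ _ _ (e ^ e) {{m^n≢0 e e}} (begin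
    S ^ e * V * e ^ e                ≡⟨ swap (S ^ e) V (e ^ e) ⟩
    e ^ e * S ^ e * V                ≡⟨ cong (_* V) (sym (^-distribʳ-* e e S)) ⟩
    (e * S) ^ e * V                  ≤⟨ *-monoˡ-≤ V (^-monoˡ-≤ e (mean-below e k j U X Z 2≤e dense eX≤U eq)) ⟩
    (n * (V * Z)) ^ e * V            ≡⟨ cong (λ x → x ^ e * V) (sym (*-assoc n V Z)) ⟩
    (n * V * Z) ^ e * V              ≡⟨ cong (_* V) (^-distribʳ-* e (n * V) Z) ⟩
    (n * V) ^ e * Z ^ e * V          ≡⟨ *-assoc ((n * V) ^ e) (Z ^ e) V ⟩
    (n * V) ^ e * (Z ^ e * V)        ≤⟨ *-monoʳ-≤ ((n * V) ^ e) (power-below e U X Z eq) ⟩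
    (n * V) ^ e * ((e * U) ^ e * U)  ≡⟨ sym (*-assoc ((n * V) ^ e) ((e * U) ^ e) U) ⟩
    (n * V) ^ e * (e * U) ^ e * U    ≡⟨ cong (_* U) (sym (^-distribʳ-* e (n * V) (e * U))) ⟩
    (n * V * (e * U)) ^ e * U        ≡⟨ cong (λ x → x ^ e * U) (reorder n V e U) ⟩
    (n * (U * V) * e) ^ e * U        ≡⟨ cong (_* U) (^-distribʳ-* e (n * (U * V)) e) ⟩
    (n * (U * V)) ^ e * e ^ e * U    ≡⟨ swap′ ((n * (U * V)) ^ e) (e ^ e) U ⟩
    (n * (U * V)) ^ e * U * e ^ e    ∎)
    where
    open ≤-Reasoning
    n = k + j
    S = k * (U * U) + j * (V * V)
    eX≤U : e * X ≤ U
    eX≤U = +-cancelʳ-≤ (e * U) _ _ (subst (_≤ U + e * U) (trans (*-distribˡ-+ e U X) (+-comm (e * U) (e * X))) small)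
    X≤eU : X ≤ e * U
    X≤eU = ≤-trans (m≤n*m X e) (≤-trans eX≤U (m≤n*m U e))
    Z = e * U ∸ X
    eq : Z + X ≡ e * U
    eq = m∸n+n≡m X≤eU
    swap : ∀ x y z → x * y * z ≡ z * x * y
    swap = solve-∀
    swap′ : ∀ x y z → x * y * z ≡ x * z * y
    swap′ = solve-∀
    reorder : ∀ n V e U → n * V * (e * U) ≡ n * (U * V) * e
    reorder = solve-∀

  product-bound : ∀ {n} e k j M (d : Fin n → ℕ) .{{_ : NonZero e}} .{{_ : NonZero M}} → 2 ≤ e → e * j + 2 * (k + j) ≤ e * k →
    (∀ s → e * suc M ^ d s ≤ suc e * M ^ d s) →
    product (λ s → k * (M ^ d s * M ^ d s) + j * (suc M ^ d s * suc M ^ d s)) ^ e * suc M ^ sum d ≤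
    ((k + j) ^ n * (M * suc M) ^ sum d) ^ e * M ^ sum d
  product-bound {n} e k j M d 2≤e dense small = begin
    product mean ^ e * suc M ^ sum d
      ≡⟨ sym (cong₂ _*_ (product-^ e mean) (product-^-sum (suc M) d)) ⟩
    product (λ s → mean s ^ e) * product (λ s → suc M ^ d s)
      ≡⟨ sym (product-distrib-* (λ s → mean s ^ e) (λ s → suc M ^ d s)) ⟩
    product (λ s → mean s ^ e * suc M ^ d s)
      ≤⟨ product-mono-≤ (λ s → factor-bound e k j (M ^ d s) (suc M ^ d s) {{it}} {{m^n≢0 M (d s)}} 2≤e dense (^-monoˡ-≤ (d s) (n≤1+n M)) (small s)) ⟩
    product (λ s → ((k + j) * (M ^ d s * suc M ^ d s)) ^ e * M ^ d s)
      ≡⟨ product-distrib-* (λ s → ((k + j) * (M ^ d s * suc M ^ d s)) ^ e) (λ s → M ^ d s) ⟩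
    product (λ s → ((k + j) * (M ^ d s * suc M ^ d s)) ^ e) * product (λ s → M ^ d s)
      ≡⟨ cong₂ _*_ (product-^ e (λ s → (k + j) * (M ^ d s * suc M ^ d s))) (product-^-sum M d) ⟩
    product (λ s → (k + j) * (M ^ d s * suc M ^ d s)) ^ e * M ^ sum d
      ≡⟨ cong (λ x → x ^ e * M ^ sum d) (trans (product-distrib-* (λ _ → k + j) (λ s → M ^ d s * suc M ^ d s))
           (cong₂ _*_ (product-const n (k + j)) (trans (product-cong λ s → sym (^-distribʳ-* (d s) M (suc M))) (product-^-sum (M * suc M) d)))) ⟩
    ((k + j) ^ n * (M * suc M) ^ sum d) ^ e * M ^ sum d ∎
    where
    open ≤-Reasoning
    mean : Fin n → ℕ
    mean s = k * (M ^ d s * M ^ d s) + j * (suc M ^ d s * suc M ^ d s)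

  weight : ∀ {n} → (Fin n → Bool) → (Fin n → ℕ) → ℕ
  weight c d = sum λ s → bit (c s) * d s

  weight+weight-not : ∀ {n} (c : Fin n → Bool) (d : Fin n → ℕ) → weight c d + weight (not ∘ c) d ≡ sum d
  weight+weight-not c d = trans (sym (∑-distrib-+ (λ s → bit (c s) * d s) (λ s → bit (not (c s)) * d s)))
    (sum-cong-≗ λ s → either (c s) (d s))
    where
    either : ∀ x m → bit x * m + bit (not x) * m ≡ m
    either true  m = trans (+-identityʳ (1 * m)) (*-identityˡ m)
    either false m = *-identityˡ m

  product-if : ∀ {n} (c : Fin n → Bool) (d : Fin n → ℕ) x y →
    product (λ s → if c s then x ^ d s else y ^ d s) ≡ x ^ weight c d * y ^ weight (not ∘ c) d
  product-if c d x y = trans (product-cong λ s → pick (c s) (d s))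
    (trans (product-distrib-* (λ s → x ^ (bit (c s) * d s)) (λ s → y ^ (bit (not (c s)) * d s)))
      (cong₂ _*_ (product-^-sum x (λ s → bit (c s) * d s)) (product-^-sum y (λ s → bit (not (c s)) * d s))))
    where
    pick : ∀ b m → (if b then x ^ m else y ^ m) ≡ x ^ (bit b * m) * y ^ (bit (not b) * m)
    pick true  m = trans (cong (x ^_) (sym (*-identityˡ m))) (sym (*-identityʳ _))
    pick false m = trans (cong (y ^_) (sym (*-identityˡ m))) (sym (*-identityˡ _))

  -- The threshold for the exponential moment: one unit of each kind together contribute M² (M + 1)²
  -- = (M (M + 1))², and every surplus unit of the second kind contributes (M + 1)² ≥ M (M + 1).
  unbalanced : ∀ M a b → a ≤ b → (M * suc M) ^ (a + b) ≤ (M * M) ^ a * (suc M * suc M) ^ b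
  unbalanced M a b a≤b with m≤n⇒∃[o]m+o≡n a≤b
  ... | c , refl = begin
    (M * W) ^ (a + (a + c))                    ≡⟨ cong ((M * W) ^_) (sym (+-assoc a a c)) ⟩
    (M * W) ^ (a + a + c)                      ≡⟨ ^-distribˡ-+-* (M * W) (a + a) c ⟩
    (M * W) ^ (a + a) * (M * W) ^ c            ≤⟨ *-monoʳ-≤ ((M * W) ^ (a + a)) (^-monoˡ-≤ c (*-monoˡ-≤ W (n≤1+n M))) ⟩
    (M * W) ^ (a + a) * (W * W) ^ c            ≡⟨ cong (_* (W * W) ^ c) (trans (^-distribˡ-+-* (M * W) a a) (trans (sym (^-distribʳ-* a (M * W) (M * W)))
                                                    (trans (cong (_^ a) (pair M W)) (^-distribʳ-* a (M * M) (W * W))))) ⟩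
    (M * M) ^ a * (W * W) ^ a * (W * W) ^ c    ≡⟨ *-assoc ((M * M) ^ a) _ _ ⟩
    (M * M) ^ a * ((W * W) ^ a * (W * W) ^ c)  ≡⟨ cong ((M * M) ^ a *_) (sym (^-distribˡ-+-* (W * W) a c)) ⟩
    (M * M) ^ a * (W * W) ^ (a + c)            ∎
    where
    open ≤-Reasoning
    W = suc M
    pair : ∀ x y → x * y * (x * y) ≡ x * x * (y * y)
    pair = solve-∀

  -- The sum over b of the products of the entries M²ᵈ (neighbour) and (M + 1)²ᵈ (non-neighbour)
  -- is an exponential moment; a permutation of at most average moment has no deviating b.
  balanced-assignment : ∀ {n} e M (N : Fin n → Fin n → Bool) (d : Fin n → ℕ) .{{_ : NonZero e}} .{{_ : NonZero M}} → 2 ≤ e →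
    sum d ≡ n → (∀ b → e * count (not ∘ N b) + 2 * n ≤ e * count (N b)) →
    (∀ s → e * suc M ^ d s ≤ suc e * M ^ d s) → (n * suc n) ^ e * M ^ n < suc M ^ n →
    ∃[ π ] ∀ b → n ≤ 2 * weight (λ s → N b (π ⟨$⟩ʳ s)) d
  balanced-assignment {n} e M N d 2≤e Σd dense small growth = proj₁ below-average , good
    where
    open ≤-Reasoning
    u v : Fin n → ℕ
    u s = (M * M) ^ d s
    v s = (suc M * suc M) ^ d s
    F : Fin n → Fin n → Fin n → ℕ
    F b = twoValued (N b) u v
    k j : Fin n → ℕ
    k b = count (N b)
    j b = count (not ∘ N b)
    Π : Fin n → ℕ
    Π b = product (λ s → k b * u s + j b * v s)
    below-average = ∃-permutation-below-average (λ _ → 1) F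
    π = proj₁ below-average
    good : ∀ b → n ≤ 2 * weight (λ s → N b (π ⟨$⟩ʳ s)) d
    good b with n ≤? 2 * weight (λ s → N b (π ⟨$⟩ʳ s)) d
    ... | yes p = p
    -- Union bound: the sum of the permanents is at most n times the largest one, so the moment need
    -- only be estimated at `b₀`, which may differ from the deviating b.
    ... | no ¬p with ∃-maximum (λ b → permanent (F b)) b
    ...   | b₀ , max = contradiction growth (≤⇒≯ contra)
      where
      a = weight (λ s → N b (π ⟨$⟩ʳ s)) d
      a′ = weight (λ s → not (N b (π ⟨$⟩ʳ s))) d
      a+a′≡n : a + a′ ≡ n
      a+a′≡n = trans (weight+weight-not (λ s → N b (π ⟨$⟩ʳ s)) d) Σd
      a≤a′ : a ≤ a′
      a≤a′ = <⇒≤ (+-cancelˡ-< a a a′ (subst₂ _<_ (cong (a +_) (+-identityʳ a)) (sym a+a′≡n) (≰⇒> ¬p)))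
      P = product (λ s → F b s (π ⟨$⟩ʳ s))
      Q = (M * suc M) ^ n
      Q≤P : Q ≤ P
      Q≤P = subst₂ _≤_ (cong ((M * suc M) ^_) a+a′≡n) (sym (product-if (λ s → N b (π ⟨$⟩ʳ s)) d (M * M) (suc M * suc M))) (unbalanced M a a′ a≤a′)
      -- The deviating b alone contributes at least `Q` to the sum that π keeps below average.
      moment : n ^ n * Q ≤ n * suc n * Π b₀
      moment = *-cancelˡ-≤ (n !) {{n !≢0}} (begin
        n ! * (n ^ n * Q)         ≤⟨ *-monoʳ-≤ (n !) (*-monoʳ-≤ (n ^ n) (≤-trans Q≤P (≤-trans (≤-reflexive (sym (*-identityˡ P))) (term≤sum (λ b → 1 * product (λ s → F b s (π ⟨$⟩ʳ s))) b)))) ⟩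
        n ! * (n ^ n * T)         ≡⟨ swap (n !) (n ^ n) T ⟩
        n ! * T * n ^ n           ≤⟨ *-monoˡ-≤ (n ^ n) (proj₂ below-average) ⟩
        sum (λ b → 1 * permanent (F b)) * n ^ n  ≡⟨ cong (_* n ^ n) (sum-cong-≗ λ b → *-identityˡ (permanent (F b))) ⟩
        sum (λ b → permanent (F b)) * n ^ n      ≤⟨ *-monoˡ-≤ (n ^ n) max ⟩
        n * permanent (F b₀) * n ^ n             ≡⟨ *-assoc n _ _ ⟩
        n * (permanent (F b₀) * n ^ n)           ≤⟨ *-monoʳ-≤ n (permanent-bound (N b₀) u v) ⟩
        n * (suc n * (n ! * Π b₀))               ≡⟨ swap′ n (suc n) (n !) (Π b₀) ⟩
        n ! * (n * suc n * Π b₀) ∎)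
        where
        T = sum (λ b → 1 * product (λ s → F b s (π ⟨$⟩ʳ s)))
        swap : ∀ x y z → x * (y * z) ≡ x * z * y
        swap = solve-∀
        swap′ : ∀ x y z w → x * (y * (z * w)) ≡ z * (x * y * w)
        swap′ = solve-∀
      tail-bound : Π b₀ ^ e * suc M ^ n ≤ (n ^ n * Q) ^ e * M ^ n
      tail-bound = subst₂ _≤_
        (cong₂ (λ x y → x ^ e * suc M ^ y) (product-cong λ s → sym (cong₂ (λ x y → k b₀ * x + j b₀ * y) (^-distribʳ-* (d s) M M) (^-distribʳ-* (d s) (suc M) (suc M)))) Σd)
        (cong₂ (λ x y → (x ^ n * (M * suc M) ^ y) ^ e * M ^ y) k+j≡n Σd)
        (product-bound e (k b₀) (j b₀) M d 2≤e (subst (λ x → e * j b₀ + 2 * x ≤ e * k b₀) (sym k+j≡n) (dense b₀)) small)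
        where
        k+j≡n : k b₀ + j b₀ ≡ n
        k+j≡n = count+count-not (N b₀)
      -- `tail-bound` controls the e-th power of `Π b₀`, so `moment` is raised to the power e before
      -- the two are combined.
      contra : suc M ^ n ≤ (n * suc n) ^ e * M ^ n
      contra = *-cancelˡ-≤ ((n ^ n * Q) ^ e) {{m^n≢0 (n ^ n * Q) e {{m*n≢0 (n ^ n) Q {{n^n≢0 n}} {{m^n≢0 (M * suc M) n {{m*n≢0 M (suc M)}}}}}}}} (begin
        (n ^ n * Q) ^ e * suc M ^ n               ≤⟨ *-monoˡ-≤ (suc M ^ n) (^-monoˡ-≤ e moment) ⟩
        (n * suc n * Π b₀) ^ e * suc M ^ n        ≡⟨ cong (_* suc M ^ n) (^-distribʳ-* e (n * suc n) (Π b₀)) ⟩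
        (n * suc n) ^ e * Π b₀ ^ e * suc M ^ n    ≡⟨ *-assoc ((n * suc n) ^ e) _ _ ⟩
        (n * suc n) ^ e * (Π b₀ ^ e * suc M ^ n)  ≤⟨ *-monoʳ-≤ ((n * suc n) ^ e) tail-bound ⟩
        (n * suc n) ^ e * ((n ^ n * Q) ^ e * M ^ n) ≡⟨ swap ((n * suc n) ^ e) ((n ^ n * Q) ^ e) (M ^ n) ⟩
        (n ^ n * Q) ^ e * ((n * suc n) ^ e * M ^ n) ∎)
        where
        swap : ∀ x y z → x * (y * z) ≡ y * (x * z)
        swap = solve-∀

-- The integer form of the theorem and the choice of M.

module Embedding where

  open import Data.Bool.Base using (Bool; true; false; not)
  open import Data.Fin.Base using (Fin; zero; suc; fromℕ<)
  open import Data.Fin.Permutation using (_⟨$⟩ʳ_; _⟨$⟩ˡ_; inverseˡ; inverseʳ)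
  open import Data.Nat.Base
  open import Data.Nat.DivMod using (/-monoˡ-≤; m*n/n≡m; m/n*n≤m)
  open import Data.Nat.Properties
  open import Data.Nat.Tactic.RingSolver using (solve-∀)
  open import Data.Product.Base using (∃-syntax; _,_; proj₁; proj₂)
  open import Data.Sum.Base using (inj₁; inj₂)
  open import Function.Base using (_∘_)
  open import Relation.Binary.PropositionalEquality
  open import Relation.Nullary using (contradiction)
  open import Defs using (BipartiteGraph; mkBipartite; edge; degree; _EmbedsInto_)
  open FiniteSums
  open Matching
  open Permanents using (count+count-not)
  open Assignment

  -- Bernoulli again: (M / (M + 1))^d ≥ 1 - d / (M + 1), with c = M + 1 - d.
  power-ratio : ∀ M c d → c + d ≡ suc M → suc M ^ d * c ≤ M ^ d * suc M
  power-ratio M c zero    eq = ≤-reflexive (cong (1 *_) (trans (sym (+-identityʳ c)) eq))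
  power-ratio M c (suc d) eq = begin
    suc M * suc M ^ d * c           ≡⟨ rotate (suc M) (suc M ^ d) c ⟩
    suc M ^ d * (c + M * c)         ≤⟨ *-monoʳ-≤ (suc M ^ d) (+-monoˡ-≤ (M * c) c≤M) ⟩
    suc M ^ d * (M + M * c)         ≡⟨ cong (suc M ^ d *_) (sym (*-suc M c)) ⟩
    suc M ^ d * (M * suc c)         ≡⟨ swap (suc M ^ d) M (suc c) ⟩
    M * (suc M ^ d * suc c)         ≤⟨ *-monoʳ-≤ M (power-ratio M (suc c) d (trans (sym (+-suc c d)) eq)) ⟩
    M * (M ^ d * suc M)             ≡⟨ sym (*-assoc M (M ^ d) (suc M)) ⟩
    M * M ^ d * suc M               ∎
    where
    open ≤-Reasoning
    c≤M : c ≤ M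
    c≤M = s≤s⁻¹ (subst (suc c ≤_) eq (≤-trans (s≤s (m≤m+n c d)) (≤-reflexive (sym (+-suc c d)))))
    rotate : ∀ x y z → x * y * z ≡ y * (x * z)
    rotate = solve-∀
    swap : ∀ x y z → x * (y * z) ≡ y * (x * z)
    swap = solve-∀

  -- From d / (M + 1) ≤ 1 / (e + 1), `power-ratio` bounds (M / (M + 1))^d below by e / (e + 1). This
  -- is the condition that one star moves the moment only slightly.
  power-small : ∀ e M d → suc e * d ≤ M → e * suc M ^ d ≤ suc e * M ^ d
  power-small e M d le = *-cancelʳ-≤ _ _ (suc M) (begin
    e * suc M ^ d * suc M             ≡⟨ rotate e (suc M ^ d) (suc M) ⟩
    suc M ^ d * (e * suc M)           ≤⟨ *-monoʳ-≤ (suc M ^ d) e*sucM≤ ⟩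
    suc M ^ d * (suc e * c)           ≡⟨ swap (suc M ^ d) (suc e) c ⟩
    suc e * (suc M ^ d * c)           ≤⟨ *-monoʳ-≤ (suc e) (power-ratio M c d c+d) ⟩
    suc e * (M ^ d * suc M)           ≡⟨ sym (*-assoc (suc e) (M ^ d) (suc M)) ⟩
    suc e * M ^ d * suc M             ∎)
    where
    open ≤-Reasoning
    c = suc M ∸ d
    c+d : c + d ≡ suc M
    c+d = m∸n+n≡m (≤-trans (m≤n*m d (suc e)) (≤-trans le (n≤1+n M)))
    e*sucM≤ : e * suc M ≤ suc e * c
    e*sucM≤ = +-cancelʳ-≤ (suc e * d) _ _ (begin
      e * suc M + suc e * d      ≤⟨ +-monoʳ-≤ (e * suc M) (≤-trans le (n≤1+n M)) ⟩
      e * suc M + suc M          ≡⟨ +-comm (e * suc M) (suc M) ⟩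
      suc e * suc M              ≡⟨ cong (suc e *_) (sym c+d) ⟩
      suc e * (c + d)            ≡⟨ *-distribˡ-+ (suc e) c d ⟩
      suc e * c + suc e * d      ∎)
    rotate : ∀ x y z → x * y * z ≡ y * (x * z)
    rotate = solve-∀
    swap : ∀ x y z → x * (y * z) ≡ y * (x * z)
    swap = solve-∀

  2*M^M≤[1+M]^M : ∀ M .{{_ : NonZero M}} → 2 * M ^ M ≤ suc M ^ M
  2*M^M≤[1+M]^M M@(suc m) = begin
    2 * M ^ M              ≡⟨ regroup M (M ^ m) ⟩
    M ^ m * (M + M * 1)    ≤⟨ bernoulli M 1 m ⟩
    (M + 1) ^ M            ≡⟨ cong (_^ M) (+-comm M 1) ⟩
    suc M ^ M              ∎
    where
    open ≤-Reasoning
    regroup : ∀ x y → 2 * (x * y) ≡ y * (x + x * 1)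
    regroup = solve-∀

  -- Every block of M factors 1 + 1/M at least doubles the product, and n has room for L blocks.
  power-growth : ∀ n M L .{{_ : NonZero M}} → M * L ≤ n → 2 ^ L * M ^ n ≤ suc M ^ n
  power-growth n M L ML≤n with m≤n⇒∃[o]m+o≡n ML≤n
  ... | r , refl = begin
    2 ^ L * M ^ (M * L + r)            ≡⟨ cong (2 ^ L *_) (^-distribˡ-+-* M (M * L) r) ⟩
    2 ^ L * (M ^ (M * L) * M ^ r)      ≡⟨ sym (*-assoc (2 ^ L) _ _) ⟩
    2 ^ L * M ^ (M * L) * M ^ r        ≡⟨ cong (λ x → 2 ^ L * x * M ^ r) (sym (^-*-assoc M M L)) ⟩
    2 ^ L * (M ^ M) ^ L * M ^ r        ≡⟨ cong (_* M ^ r) (sym (^-distribʳ-* L 2 (M ^ M))) ⟩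
    (2 * M ^ M) ^ L * M ^ r            ≤⟨ *-mono-≤ (^-monoˡ-≤ L (2*M^M≤[1+M]^M M)) (^-monoˡ-≤ r (n≤1+n M)) ⟩
    (suc M ^ M) ^ L * suc M ^ r        ≡⟨ cong (_* suc M ^ r) (^-*-assoc (suc M) M L) ⟩
    suc M ^ (M * L) * suc M ^ r        ≡⟨ sym (^-distribˡ-+-* (suc M) (M * L) r) ⟩
    suc M ^ (M * L + r)                ∎
    where open ≤-Reasoning

  -- Here n and n + 1 are at most 2^(K + 1), so 2 (K + 1) e doublings outgrow (n (n + 1))^e.
  polynomial<exponential : ∀ n M e K .{{_ : NonZero e}} .{{_ : NonZero M}} → n < 2 ^ suc K → M * ((suc K + suc K) * e) ≤ n →
    (n * suc n) ^ e * M ^ n < suc M ^ n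
  polynomial<exponential n M e K n<2^K ML≤n = begin-strict
    (n * suc n) ^ e * M ^ n                     <⟨ *-monoˡ-< (M ^ n) {{m^n≢0 M n}} (^-monoˡ-< e (*-mono-<-≤ n<2^K n<2^K)) ⟩
    (2 ^ suc K * 2 ^ suc K) ^ e * M ^ n         ≡⟨ cong (λ x → x ^ e * M ^ n) (sym (^-distribˡ-+-* 2 (suc K) (suc K))) ⟩
    (2 ^ (suc K + suc K)) ^ e * M ^ n           ≡⟨ cong (_* M ^ n) (^-*-assoc 2 (suc K + suc K) e) ⟩
    2 ^ ((suc K + suc K) * e) * M ^ n           ≤⟨ power-growth n M ((suc K + suc K) * e) ML≤n ⟩
    suc M ^ n                                   ∎
    where
    open ≤-Reasoning
    *-mono-<-≤ : ∀ {a b c d} → a < b → c ≤ d → .{{NonZero c}} → a * c < b * d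
    *-mono-<-≤ {a} {b} {c} {d} a<b c≤d = <-≤-trans (*-monoˡ-< c a<b) (*-monoʳ-≤ b c≤d)

  count≡0⇒false : ∀ {n} (f : Fin n → Bool) → count f ≡ 0 → ∀ i → f i ≢ true
  count≡0⇒false f eq i fi with ≤-trans (≤-reflexive (cong bit (sym fi))) (≤-trans (term≤sum (bit ∘ f) i) (≤-reflexive eq))
  ... | ()

  count≡1⇒unique : ∀ {n} (f : Fin n → Bool) → count f ≡ 1 → ∀ i j → f i ≡ true → f j ≡ true → i ≡ j
  count≡1⇒unique f eq zero    zero    fi fj = refl
  count≡1⇒unique f eq zero    (suc j) fi fj rewrite fi = contradiction fj (count≡0⇒false (f ∘ suc) (suc-injective eq) j)
  count≡1⇒unique f eq (suc i) zero    fi fj rewrite fj = contradiction fi (count≡0⇒false (f ∘ suc) (suc-injective eq) i)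
  count≡1⇒unique f eq (suc i) (suc j) fi fj with f zero
  ... | true  = contradiction fi (count≡0⇒false (f ∘ suc) (suc-injective eq) i)
  ... | false = cong suc (count≡1⇒unique (f ∘ suc) eq i j fi fj)

  sum-singleton : ∀ {n} (f : Fin n → Bool) → count f ≡ 1 → ∀ i → f i ≡ true → (g : Fin n → ℕ) → sum (λ s → g s * bit (f s)) ≡ g i
  sum-singleton f eq i fi g = begin
    sum (λ s → g s * bit (f s))  ≡⟨ sum-cong-≗ at ⟩
    sum (λ s → g i * bit (f s))  ≡⟨ sym (*-distribˡ-sum (g i) (bit ∘ f)) ⟩
    g i * count f                ≡⟨ cong (g i *_) eq ⟩
    g i * 1                      ≡⟨ *-identityʳ (g i) ⟩
    g i                          ∎
    where
    open ≡-Reasoning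
    at : ∀ s → g s * bit (f s) ≡ g i * bit (f s)
    at s with f s in fs
    ... | true  = cong (λ x → g x * 1) (count≡1⇒unique f eq s i fs fi)
    ... | false = trans (*-zeroʳ (g s)) (sym (*-zeroʳ (g i)))

  -- Here 1/e replaces ε and K the binary logarithm of n: degrees in G are at least (½ + 1/e) n, and
  -- sparsity leaves room for an M between (e + 1) times the largest star and n / (2 (K + 1) e).
  embeds : ∀ n e K .{{_ : NonZero n}} (G H : BipartiteGraph n n) → 2 ≤ e → n < 2 ^ suc K →
    (∀ x → (e + 2) * n ≤ 2 * (e * degree G x)) →
    (∀ s → suc e * degree H (inj₁ s) * ((suc K + suc K) * e) ≤ n) →
    (∀ t → degree H (inj₂ t) ≡ 1) → H EmbedsInto G
  embeds n e K G H 2≤e n<2^K dense sparse single =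
    -- The copy of H transported along σ and τ is isomorphic to H by construction; only its
    -- inclusion in G needs the matching.
    mkBipartite (λ a b → edge H (σ ⟨$⟩ˡ a) (τ ⟨$⟩ˡ b)) , subgraph ,
    σ , τ , λ s t → sym (cong₂ (edge H) (inverseˡ σ) (inverseˡ τ))
    where
    open ≤-Reasoning
    instance
      e≢0 : NonZero e
      e≢0 = >-nonZero (≤-trans (s≤s z≤n) 2≤e)

    L = (suc K + suc K) * e

    instance
      L≢0 : NonZero L
      L≢0 = m*n≢0 (suc K + suc K) e

    -- The largest M that leaves room for `L` doublings; `sparse` then says exactly that (e + 1)
    -- `d s` fits below it.
    M = n / L

    d : Fin n → ℕ
    d s = count (edge H s)

    column : ∀ t → count (λ s → edge H s t) ≡ 1
    column t = trans (sym (∣tabulate∣≡count (λ s → edge H s t))) (single t)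

    centre : ∀ t → ∃[ s ] edge H s t ≡ true
    centre t = 0<count⇒∃ (λ s → edge H s t) (≤-reflexive (sym (column t)))

    h : Fin n → Fin n
    h t = proj₁ (centre t)

    Σd : sum d ≡ n
    Σd = trans (∑-comm (λ s t → bit (edge H s t))) (trans (sum-cong-≗ column) (sum-ones n))

    d≤M : ∀ s → suc e * d s ≤ M
    d≤M s = subst (_≤ M) (m*n/n≡m (suc e * d s) L) (/-monoˡ-≤ L (subst (λ x → suc e * x * L ≤ n) (∣tabulate∣≡count (edge H s)) (sparse s)))

    instance
      M≢0 : NonZero M
      -- As n is positive there is a leaf; its centre has degree at least 1, and M is at least (e +
      -- 1) times that degree.
      M≢0 = >-nonZero (begin-strict
        0                     <⟨ s≤s z≤n ⟩
        1                     ≡⟨ cong bit (sym (proj₂ (centre t₀))) ⟩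
        bit (edge H (h t₀) t₀) ≤⟨ term≤sum (bit ∘ edge H (h t₀)) t₀ ⟩
        d (h t₀)              ≤⟨ m≤n*m (d (h t₀)) (suc e) ⟩
        suc e * d (h t₀)      ≤⟨ d≤M (h t₀) ⟩
        M                     ∎)
        where
        t₀ : Fin n
        t₀ = fromℕ< (>-nonZero⁻¹ n)

    N : Fin n → Fin n → Bool
    N b a = edge G a b

    dense-column : ∀ b → e * count (not ∘ N b) + 2 * n ≤ e * count (N b)
    dense-column b = +-cancelʳ-≤ (e * k) _ _ (begin
      e * j + 2 * n + e * k   ≡⟨ regroup e j n k ⟩
      e * (k + j) + 2 * n     ≡⟨ cong (λ x → e * x + 2 * n) (count+count-not (N b)) ⟩
      e * n + 2 * n           ≡⟨ sym (*-distribʳ-+ n e 2) ⟩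
      (e + 2) * n             ≤⟨ dense (inj₂ b) ⟩
      2 * (e * degree G (inj₂ b)) ≡⟨ cong (λ x → 2 * (e * x)) (∣tabulate∣≡count (N b)) ⟩
      2 * (e * k)             ≡⟨ cong (e * k +_) (+-identityʳ (e * k)) ⟩
      e * k + e * k           ∎)
      where
      k = count (N b)
      j = count (not ∘ N b)
      regroup : ∀ e j n k → e * j + 2 * n + e * k ≡ e * (k + j) + 2 * n
      regroup = solve-∀

    dense-row : ∀ a → n < 2 * count (edge G a)
    dense-row a = *-cancelˡ-< e n _ (begin-strict
      e * n                        <⟨ m<m+n (e * n) (>-nonZero⁻¹ (2 * n) {{m*n≢0 2 n}}) ⟩
      e * n + 2 * n                ≡⟨ sym (*-distribʳ-+ n e 2) ⟩
      (e + 2) * n                  ≤⟨ dense (inj₁ a) ⟩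
      2 * (e * degree G (inj₁ a))  ≡⟨ cong (λ x → 2 * (e * x)) (∣tabulate∣≡count (edge G a)) ⟩
      2 * (e * count (edge G a))   ≡⟨ swap e (count (edge G a)) ⟩
      e * (2 * count (edge G a))   ∎)
      where
      swap : ∀ x y → 2 * (x * y) ≡ x * (2 * y)
      swap = solve-∀

    balanced = balanced-assignment e M N d 2≤e Σd dense-column
      (λ s → power-small e M (d s) (d≤M s)) (polynomial<exponential n M e K n<2^K (m/n*n≤m n L))

    σ = proj₁ balanced

    -- Each centre is replaced by its leaves, which turns the degree-weighted count of centres into
    -- a column degree of the graph to be matched.
    weight≡count : ∀ b → weight (λ s → N b (σ ⟨$⟩ʳ s)) d ≡ count (λ t → N b (σ ⟨$⟩ʳ h t))
    weight≡count b = trans (sum-cong-≗ λ s → *-distribˡ-sum (g s) (bit ∘ edge H s))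
      (trans (∑-comm λ s t → g s * bit (edge H s t))
        (sum-cong-≗ λ t → sum-singleton (λ s → edge H s t) (column t) (h t) (proj₂ (centre t)) g))
      where
      g : Fin n → ℕ
      g s = bit (N b (σ ⟨$⟩ʳ s))

    matching = perfect-matching (λ t b → edge G (σ ⟨$⟩ʳ h t) b) (λ t → dense-row (σ ⟨$⟩ʳ h t))
      (λ b → subst (λ x → n ≤ 2 * x) (weight≡count b) (proj₂ balanced b))

    τ = proj₁ matching

    subgraph : ∀ a b → edge H (σ ⟨$⟩ˡ a) (τ ⟨$⟩ˡ b) ≡ true → edge G a b ≡ true
    subgraph a b ab = trans
      -- A leaf has only one neighbour in H, so the preimage of a is the centre `h t`, for which the
      -- matching supplies the edge of G.
      (cong₂ (edge G) (trans (sym (inverseʳ σ)) (cong (σ ⟨$⟩ʳ_) (count≡1⇒unique (λ s → edge H s t) (column t) (σ ⟨$⟩ˡ a) (h t) ab (proj₂ (centre t)))))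
        (sym (inverseʳ τ)))
      (proj₂ matching t)
      where t = τ ⟨$⟩ˡ b

-- From inequalities between Cauchy reals to inequalities in ℕ.

module Reals where

  open import Data.Integer.Base as ℤ using (+_; +≤+)
  import Data.Integer.Properties as ℤ
  open import Data.Nat.Base as ℕ using (ℕ; zero; suc; z≤n; s≤s)
  open import Data.Nat.Coprimality using (1-coprimeTo) renaming (sym to coprime-sym)
  import Data.Nat.Properties as ℕ
  open import Data.Nat.Tactic.RingSolver using (solve-∀)
  open import Data.Product.Base using (∃-syntax; _×_; _,_; proj₁; proj₂)
  open import Data.Rational.Base as ℚ using (ℚ; mkℚ; 0ℚ; 1ℚ; ½; *≤*)
  import Data.Rational.Properties as ℚ
  open import Data.Rational.Solver using (module +-*-Solver)
  open import Data.Sum.Base using (inj₁; inj₂)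
  open import Relation.Binary.PropositionalEquality
  open import Relation.Nullary using (¬_; yes; no; contradiction)
  open import Relation.Unary using (Decidable)
  open import Defs
  open RealLemmas
  open LogLemmas
  open +-*-Solver using (solve; con; _:=_; _:+_; _:*_; _:-_)
  open ℚ.≤-Reasoning

  ι : ℕ → ℚ
  ι n = + n ℚ./ 1

  ι-normal : ∀ n → ι n ≡ mkℚ (+ n) 0 (coprime-sym (1-coprimeTo n))
  ι-normal n = ℚ.normalize-coprime (coprime-sym (1-coprimeTo n))

  ι-mono : ∀ {m n} → m ℕ.≤ n → ι m ℚ.≤ ι n
  ι-mono {m} {n} m≤n = subst₂ ℚ._≤_ (sym (ι-normal m)) (sym (ι-normal n)) (*≤* (ℤ.*-monoʳ-≤-nonNeg (+ 1) (+≤+ m≤n)))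

  ι-cancel : ∀ {m n} → ι m ℚ.≤ ι n → m ℕ.≤ n
  ι-cancel {m} {n} le = ℤ.drop‿+≤+ (subst₂ ℤ._≤_ (ℤ.*-identityʳ (+ m)) (ℤ.*-identityʳ (+ n))
    (ℚ.drop-*≤* (subst₂ ℚ._≤_ (ι-normal m) (ι-normal n) le)))

  0≤ι : ∀ n → 0ℚ ℚ.≤ ι n
  0≤ι n = ι-mono {0} {n} z≤n

  ι-+ : ∀ m n → ι (m ℕ.+ n) ≡ ι m ℚ.+ ι n
  ι-+ m n = sym (trans (cong₂ ℚ._+_ (ι-normal m) (ι-normal n))
    (cong (ℚ._/ 1) (cong₂ ℤ._+_ (ℤ.*-identityʳ (+ m)) (ℤ.*-identityʳ (+ n)))))

  ι-* : ∀ m n → ι (m ℕ.* n) ≡ ι m ℚ.* ι n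
  ι-* m n = sym (trans (cong₂ ℚ._*_ (ι-normal m) (ι-normal n)) (cong (ℚ._/ 1) (sym (ℤ.pos-* m n))))

  ι-suc : ∀ n → ι (suc n) ≡ 1ℚ ℚ.+ ι n
  ι-suc = ι-+ 1

  ι-unit : ∀ k → ι (suc k) ℚ.* unit k ≡ 1ℚ
  ι-unit k = trans (cong₂ ℚ._*_ (ι-normal (suc k)) (unit-normal k)) (ℚ.*-inverseʳ (mkℚ (+ suc k) 0 (coprime-sym (1-coprimeTo (suc k)))))

  crossing : ∀ {P : ℕ → Set} → Decidable P → ¬ P 0 → ∀ m → P m → ∃[ k ] ¬ P k × P (suc k)
  crossing P? ¬P0 zero    Pm = contradiction Pm ¬P0
  crossing P? ¬P0 (suc m) Pm with P? m
  ... | no ¬Pm = m , ¬Pm , Pm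
  ... | yes Pm′ = crossing P? ¬P0 m Pm′

  ≤-by : ∀ {p q r} → 0ℚ ℚ.≤ r → p ℚ.+ r ≡ q → p ℚ.≤ q
  ≤-by {p} {q} {r} 0≤r eq = subst₂ ℚ._≤_ (ℚ.+-identityʳ p) eq (ℚ.+-monoʳ-≤ p 0≤r)

  <⇒≱ : ∀ {p q} → p ℚ.< q → ¬ (q ℚ.≤ p)
  <⇒≱ p<q q≤p = ℚ.<-irrefl refl (ℚ.<-≤-trans p<q q≤p)

  p≤∣p∣ : ∀ p → p ℚ.≤ ℚ.∣ p ∣
  p≤∣p∣ p with ℚ.≤-total 0ℚ p
  ... | inj₁ 0≤p = ℚ.≤-reflexive (sym (ℚ.0≤p⇒∣p∣≡p 0≤p))
  ... | inj₂ p≤0 = ℚ.≤-trans p≤0 (ℚ.0≤∣p∣ p)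

  -- A lower bound for the logarithm through harmonic numbers.

  harmonic : ℕ → ℚ
  harmonic zero    = 0ℚ
  harmonic (suc m) = harmonic m ℚ.+ unit m

  -- The c added terms are all at least 1/(b + 1), which is `unit b`. With c = m and b + 1 = 2m this
  -- yields the classical gain of ½ per doubling.
  harmonic-block : ∀ m c b → m ℕ.+ c ℕ.≤ suc b → harmonic m ℚ.+ ι c ℚ.* unit b ℚ.≤ harmonic (m ℕ.+ c)
  harmonic-block m zero    b le = ℚ.≤-reflexive (trans (solve 2 (λ h u → h :+ con 0ℚ :* u := h) refl (harmonic m) (unit b)) (cong harmonic (sym (ℕ.+-identityʳ m))))
  harmonic-block m (suc c) b le = begin
    harmonic m ℚ.+ ι (suc c) ℚ.* unit b               ≡⟨ cong (λ x → harmonic m ℚ.+ x ℚ.* unit b) (ι-suc c) ⟩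
    harmonic m ℚ.+ (1ℚ ℚ.+ ι c) ℚ.* unit b            ≡⟨ solve 3 (λ h c u → h :+ (con 1ℚ :+ c) :* u := (h :+ c :* u) :+ u) refl (harmonic m) (ι c) (unit b) ⟩
    harmonic m ℚ.+ ι c ℚ.* unit b ℚ.+ unit b          ≤⟨ ℚ.+-mono-≤ (harmonic-block m c b (ℕ.≤-trans (ℕ.n≤1+n _) le′)) (unit-antitone (ℕ.s≤s⁻¹ le′)) ⟩
    harmonic (m ℕ.+ c) ℚ.+ unit (m ℕ.+ c)             ≡⟨ cong harmonic (sym (ℕ.+-suc m c)) ⟩
    harmonic (m ℕ.+ suc c)                            ∎
    where
    le′ : suc (m ℕ.+ c) ℕ.≤ suc b
    le′ = subst (ℕ._≤ suc b) (ℕ.+-suc m c) le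

  harmonic-mono : ∀ {m n} → m ℕ.≤ n → harmonic m ℚ.≤ harmonic n
  harmonic-mono {m} {n} m≤n with ℕ.m≤n⇒∃[o]m+o≡n m≤n
  ... | c , refl = ℚ.≤-trans (≤-by (*-nonNeg (0≤ι c) (ℚ.<⇒≤ (unit>0 (m ℕ.+ c)))) refl) (harmonic-block m c (m ℕ.+ c) (ℕ.n≤1+n _))

  harmonic-doubling : ∀ m .{{_ : ℕ.NonZero m}} → harmonic m ℚ.+ ½ ℚ.≤ harmonic (m ℕ.+ m)
  harmonic-doubling m@(suc m-1) = subst (λ x → harmonic m ℚ.+ x ℚ.≤ harmonic (m ℕ.+ m)) half (harmonic-block m m b ℕ.≤-refl)
    where
    b = m-1 ℕ.+ m
    half : ι m ℚ.* unit b ≡ ½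
    half = begin-equality
      ι m ℚ.* unit b                     ≡⟨ solve 2 (λ x u → x :* u := con ½ :* ((x :+ x) :* u)) refl (ι m) (unit b) ⟩
      ½ ℚ.* ((ι m ℚ.+ ι m) ℚ.* unit b)   ≡⟨ cong (λ x → ½ ℚ.* (x ℚ.* unit b)) (sym (ι-+ m m)) ⟩
      ½ ℚ.* (ι (suc b) ℚ.* unit b)       ≡⟨ cong (½ ℚ.*_) (ι-unit b) ⟩
      ½                                  ∎

  harmonic-2^ : ∀ K → 1ℚ ℚ.+ ι K ℚ.* ½ ℚ.≤ harmonic (2 ℕ.^ K)
  harmonic-2^ zero    = ℚ.≤-refl
  harmonic-2^ (suc K) = begin
    1ℚ ℚ.+ ι (suc K) ℚ.* ½           ≡⟨ cong (λ x → 1ℚ ℚ.+ x ℚ.* ½) (ι-suc K) ⟩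
    1ℚ ℚ.+ (1ℚ ℚ.+ ι K) ℚ.* ½        ≡⟨ solve 1 (λ k → con 1ℚ :+ (con 1ℚ :+ k) :* con ½ := (con 1ℚ :+ k :* con ½) :+ con ½) refl (ι K) ⟩
    1ℚ ℚ.+ ι K ℚ.* ½ ℚ.+ ½           ≤⟨ ℚ.+-monoˡ-≤ ½ (harmonic-2^ K) ⟩
    harmonic (2 ℕ.^ K) ℚ.+ ½         ≤⟨ harmonic-doubling (2 ℕ.^ K) {{ℕ.m^n≢0 2 K}} ⟩
    harmonic (2 ℕ.^ K ℕ.+ 2 ℕ.^ K)   ≡⟨ cong (λ x → harmonic (2 ℕ.^ K ℕ.+ x)) (sym (ℕ.+-identityʳ (2 ℕ.^ K))) ⟩
    harmonic (2 ℕ.^ suc K)           ∎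

  module LogBound (k : ℕ) where
    open Series (1-1/n k) (1-1/n≥0 k) (1-q>0 k)

    u q : ℚ
    u = unit k
    q = 1-1/n k

    power-bernoulli : ∀ m → 1ℚ ℚ.- ι m ℚ.* u ℚ.≤ q ^ℚ m
    power-bernoulli zero    = ℚ.≤-reflexive (solve 1 (λ u → con 1ℚ :- con 0ℚ :* u := con 1ℚ) refl u)
    power-bernoulli (suc m) = begin
      1ℚ ℚ.- ι (suc m) ℚ.* u                ≡⟨ cong (λ x → 1ℚ ℚ.- x ℚ.* u) (ι-suc m) ⟩
      1ℚ ℚ.- (1ℚ ℚ.+ ι m) ℚ.* u             ≤⟨ ≤-by (*-nonNeg (0≤ι m) (*-nonNeg (ℚ.<⇒≤ (unit>0 k)) (ℚ.<⇒≤ (unit>0 k))))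
                                                 (solve 2 (λ m u → (con 1ℚ :- (con 1ℚ :+ m) :* u) :+ m :* (u :* u) := (con 1ℚ :- u) :* (con 1ℚ :- m :* u)) refl (ι m) u) ⟩
      q ℚ.* (1ℚ ℚ.- ι m ℚ.* u)              ≤⟨ *-sub q (1-1/n≥0 k) (power-bernoulli m) ⟩
      q ℚ.* q ^ℚ m                          ∎

    -- Termwise, with q = 1 - u: q^m / m ≥ (1 - m u) / m = 1/m - u.
    mercator≥harmonic : ∀ m → harmonic m ℚ.- ι m ℚ.* u ℚ.≤ mercator q m
    mercator≥harmonic zero    = ℚ.≤-reflexive (solve 1 (λ u → con 0ℚ :- con 0ℚ :* u := con 0ℚ) refl u)
    mercator≥harmonic (suc m) = begin
      harmonic m ℚ.+ unit m ℚ.- ι (suc m) ℚ.* u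
        ≡⟨ cong₂ (λ x y → harmonic m ℚ.+ unit m ℚ.- x ℚ.* y) (ι-suc m) refl ⟩
      harmonic m ℚ.+ unit m ℚ.- (1ℚ ℚ.+ ι m) ℚ.* u
        ≡⟨ solve 4 (λ h w m u → (h :+ w) :- (con 1ℚ :+ m) :* u := (h :- m :* u) :+ (w :- con 1ℚ :* u)) refl (harmonic m) (unit m) (ι m) u ⟩
      (harmonic m ℚ.- ι m ℚ.* u) ℚ.+ (unit m ℚ.- 1ℚ ℚ.* u)
        ≡⟨ cong (λ x → (harmonic m ℚ.- ι m ℚ.* u) ℚ.+ (unit m ℚ.- x ℚ.* u)) (sym (ι-unit m)) ⟩
      (harmonic m ℚ.- ι m ℚ.* u) ℚ.+ (unit m ℚ.- ι (suc m) ℚ.* unit m ℚ.* u)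
        ≡⟨ cong ((harmonic m ℚ.- ι m ℚ.* u) ℚ.+_) (solve 3 (λ w n u → w :- n :* w :* u := w :* (con 1ℚ :- n :* u)) refl (unit m) (ι (suc m)) u) ⟩
      (harmonic m ℚ.- ι m ℚ.* u) ℚ.+ unit m ℚ.* (1ℚ ℚ.- ι (suc m) ℚ.* u)
        ≤⟨ ℚ.+-mono-≤ (mercator≥harmonic m) (*-sub (unit m) (ℚ.<⇒≤ (unit>0 m)) (power-bernoulli (suc m))) ⟩
      mercator q m ℚ.+ unit m ℚ.* q ^ℚ suc m
        ≡⟨ cong (mercator q m ℚ.+_) (ℚ.*-comm (unit m) (q ^ℚ suc m)) ⟩
      mercator q m ℚ.+ q ^ℚ suc m ℚ.* unit m ∎

    -- Stopping after n = `suc k` terms makes the loss n u exactly 1, which the leading 1 of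
    -- `harmonic-2^` absorbs. Later partial sums only grow.
    mercator-lower : ∀ K → 2 ℕ.^ K ℕ.≤ suc k → ∀ i → suc k ℕ.≤ i → ι K ℚ.* ½ ℚ.≤ mercator q i
    mercator-lower K 2^K≤n i n≤i = begin
      ι K ℚ.* ½                                       ≡⟨ solve 1 (λ x → x := (con 1ℚ :+ x) :- con 1ℚ) refl (ι K ℚ.* ½) ⟩
      (1ℚ ℚ.+ ι K ℚ.* ½) ℚ.- 1ℚ                       ≤⟨ ℚ.+-monoˡ-≤ (ℚ.- 1ℚ) (ℚ.≤-trans (harmonic-2^ K) (harmonic-mono 2^K≤n)) ⟩
      harmonic (suc k) ℚ.- 1ℚ                         ≡⟨ cong (λ x → harmonic (suc k) ℚ.- x) (sym (ι-unit k)) ⟩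
      harmonic (suc k) ℚ.- ι (suc k) ℚ.* u            ≤⟨ mercator≥harmonic (suc k) ⟩
      mercator q (suc k)                              ≤⟨ mono n≤i ⟩
      mercator q i                                    ∎

  log-lower : ∀ n K → 2 ℕ.^ K ℕ.≤ n → ∀ i → n ℕ.≤ i → ι K ℚ.* ½ ℚ.≤ seq (log n) i
  log-lower zero    K 2^K≤0 = contradiction 2^K≤0 (ℕ.<⇒≱ (ℕ.m^n>0 2 K))
  log-lower (suc k) K 2^K≤n = LogBound.mercator-lower k K 2^K≤n

  -- An integer stand-in for 1/ε. The bound 1 ≤ eε lets 1/e replace ε in the degrees of G; eε ≤ 3
  -- keeps e small enough for powers of ε in the sparsity bound to cancel powers of e.
  record Scale (ε : ℝ) : Set where
    field
      e        : ℕ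
      2≤e      : 2 ℕ.≤ e
      onset    : ℕ
      1≤eε     : ∀ i → onset ℕ.≤ i → 1ℚ ℚ.≤ ι e ℚ.* seq ε i
      eε≤3     : ∀ i → onset ℕ.≤ i → ι e ℚ.* seq ε i ℚ.≤ ι 3
      0≤ε      : ∀ i → onset ℕ.≤ i → 0ℚ ℚ.≤ seq ε i
      ε≤½      : ∀ i → onset ℕ.≤ i → seq ε i ℚ.≤ ½

  scale : ∀ ε → 0ℝ < ε → ε < fromℚ ½ → Scale ε
  scale ε 0<ε ε<½ = record
    { e     = suc k
    ; 2≤e   = s≤s (1≤k k (proj₂ (proj₂ crossed)))
    ; onset = I′
    ; 1≤eε  = λ i le → ℚ.≤-trans (proj₂ (proj₂ crossed)) (*-sub (ι (suc k)) (0≤ι (suc k)) (q≤ε i le))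
    ; eε≤3  = λ i le → begin
        ι (suc k) ℚ.* seq ε i        ≤⟨ *-sub (ι (suc k)) (0≤ι (suc k)) (ε≤2q i le) ⟩
        ι (suc k) ℚ.* (q ℚ.+ q)      ≡⟨ cong (ℚ._* (q ℚ.+ q)) (ι-suc k) ⟩
        (1ℚ ℚ.+ ι k) ℚ.* (q ℚ.+ q)   ≡⟨ solve 2 (λ k q → (con 1ℚ :+ k) :* (q :+ q) := (q :+ k :* q) :+ (q :+ k :* q)) refl (ι k) q ⟩
        (q ℚ.+ ι k ℚ.* q) ℚ.+ (q ℚ.+ ι k ℚ.* q) ≤⟨ ℚ.+-mono-≤ q+kq≤ q+kq≤ ⟩
        (½ ℚ.+ 1ℚ) ℚ.+ (½ ℚ.+ 1ℚ)    ≡⟨⟩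
        ι 3                          ∎
    ; 0≤ε   = λ i le → ℚ.≤-trans (ℚ.<⇒≤ 0<q) (q≤ε i le)
    ; ε≤½   = ε≤½
    }
    where
    -- A quarter of the gap gives c ≥ 4δ, so late terms of ε, at most c + δ, lie between q = c - δ
    -- and 2q.
    δ = ½ ℚ.* (½ ℚ.* gap 0<ε)
    0<δ : 0ℚ ℚ.< δ
    0<δ = *-pos 0<½ (*-pos 0<½ (gap>0 0<ε))
    C = cauchy ε δ 0<δ
    I I′ : ℕ
    I = proj₁ C ℕ.⊔ from 0<ε
    I′ = I ℕ.⊔ from ε<½
    c = seq ε I
    q = c ℚ.- δ

    I≤ : ∀ i → I′ ℕ.≤ i → I ℕ.≤ i
    I≤ i = ℕ.m⊔n≤o⇒m≤o I (from ε<½)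

    ε≤½ : ∀ i → I′ ℕ.≤ i → seq ε i ℚ.≤ ½
    ε≤½ i le = ℚ.≤-trans (≤-by (ℚ.<⇒≤ (gap>0 ε<½)) refl) (spaced ε<½ i (ℕ.m⊔n≤o⇒n≤o I (from ε<½) le))

    4δ≤c : (δ ℚ.+ δ) ℚ.+ (δ ℚ.+ δ) ℚ.≤ c
    4δ≤c = subst (ℚ._≤ c) (solve 1 (λ g → con 0ℚ :+ g := ((con ½ :* (con ½ :* g)) :+ (con ½ :* (con ½ :* g))) :+ ((con ½ :* (con ½ :* g)) :+ (con ½ :* (con ½ :* g)))) refl (gap 0<ε))
      (spaced 0<ε I (ℕ.m≤n⊔m (proj₁ C) (from 0<ε)))

    near : ∀ i j → I ℕ.≤ i → I ℕ.≤ j → seq ε i ℚ.≤ seq ε j ℚ.+ δ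
    near i j I≤i I≤j = begin
      seq ε i                                       ≡⟨ solve 2 (λ x y → x := y :+ (x :- y)) refl (seq ε i) (seq ε j) ⟩
      seq ε j ℚ.+ (seq ε i ℚ.- seq ε j)             ≤⟨ ℚ.+-monoʳ-≤ (seq ε j) (ℚ.≤-trans (p≤∣p∣ (seq ε i ℚ.- seq ε j))
                                                         (proj₂ C i j (ℕ.m⊔n≤o⇒m≤o (proj₁ C) (from 0<ε) I≤i) (ℕ.m⊔n≤o⇒m≤o (proj₁ C) (from 0<ε) I≤j))) ⟩
      seq ε j ℚ.+ δ                                 ∎

    q≤ε : ∀ i → I′ ℕ.≤ i → q ℚ.≤ seq ε i
    q≤ε i le = begin
      c ℚ.- δ                ≤⟨ ℚ.+-monoˡ-≤ (ℚ.- δ) (near I i ℕ.≤-refl (I≤ i le)) ⟩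
      seq ε i ℚ.+ δ ℚ.- δ    ≡⟨ solve 2 (λ x d → x :+ d :- d := x) refl (seq ε i) δ ⟩
      seq ε i                ∎

    0≤3δ : 0ℚ ℚ.≤ c ℚ.- ((δ ℚ.+ δ) ℚ.+ δ)
    0≤3δ = begin
      0ℚ                                                        ≤⟨ ℚ.<⇒≤ 0<δ ⟩
      δ                                                         ≡⟨ solve 1 (λ d → d := ((d :+ d) :+ (d :+ d)) :- ((d :+ d) :+ d)) refl δ ⟩
      ((δ ℚ.+ δ) ℚ.+ (δ ℚ.+ δ)) ℚ.- ((δ ℚ.+ δ) ℚ.+ δ)           ≤⟨ ℚ.+-monoˡ-≤ (ℚ.- ((δ ℚ.+ δ) ℚ.+ δ)) 4δ≤c ⟩
      c ℚ.- ((δ ℚ.+ δ) ℚ.+ δ)                                   ∎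

    ε≤2q : ∀ i → I′ ℕ.≤ i → seq ε i ℚ.≤ q ℚ.+ q
    ε≤2q i le = ℚ.≤-trans (near i I (I≤ i le) ℕ.≤-refl)
      (≤-by 0≤3δ (solve 2 (λ c d → (c :+ d) :+ (c :- ((d :+ d) :+ d)) := (c :- d) :+ (c :- d)) refl c δ))

    0<q : 0ℚ ℚ.< q
    0<q = ℚ.<-≤-trans (ℚ.+-mono-<-≤ 0<δ (ℚ.+-mono-≤ (ℚ.<⇒≤ 0<δ) 0≤3δ))
      (ℚ.≤-reflexive (solve 2 (λ c d → d :+ (d :+ (c :- ((d :+ d) :+ d))) := c :- d) refl c δ))

    q≤½ : q ℚ.≤ ½
    q≤½ = ℚ.≤-trans (q≤ε I′ ℕ.≤-refl) (ε≤½ I′ ℕ.≤-refl)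

    -- With kq < 1 and q ≤ ½, the integer e = k + 1 satisfies 1 ≤ eq ≤ 3/2, and the factor 2 between
    -- q and ε gives the constant 3.
    crossed : ∃[ k ] ¬ (1ℚ ℚ.≤ ι k ℚ.* q) × 1ℚ ℚ.≤ ι (suc k) ℚ.* q
    crossed = crossing (λ k → 1ℚ ℚ.≤? ι k ℚ.* q)
      (λ le → contradiction (subst (1ℚ ℚ.≤_) (ℚ.*-zeroˡ q) le) (<⇒≱ (ℚ.positive⁻¹ 1ℚ)))
      (suc (proj₁ (archimedes q 0<q)))
      (subst (ℚ._≤ ι (suc (proj₁ (archimedes q 0<q))) ℚ.* q) (ι-unit (proj₁ (archimedes q 0<q)))
        (*-sub (ι (suc (proj₁ (archimedes q 0<q)))) (0≤ι (suc (proj₁ (archimedes q 0<q)))) (proj₂ (archimedes q 0<q))))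

    k = proj₁ crossed

    q+kq≤ : q ℚ.+ ι k ℚ.* q ℚ.≤ ½ ℚ.+ 1ℚ
    q+kq≤ = ℚ.+-mono-≤ q≤½ (ℚ.<⇒≤ (ℚ.≰⇒> (proj₁ (proj₂ crossed))))

    1≤k : ∀ k → 1ℚ ℚ.≤ ι (suc k) ℚ.* q → 1 ℕ.≤ k
    1≤k (suc k) _  = s≤s z≤n
    1≤k zero    le = contradiction (ℚ.≤-trans le (ℚ.≤-trans (ℚ.≤-reflexive (ℚ.*-identityˡ q)) q≤½)) (<⇒≱ (ℚ.*<* (ℤ.+<+ (s≤s (s≤s z≤n)))))

  module _ {ε : ℝ} (S : Scale ε) where
    open Scale S

    -- A real inequality is evaluated at one index beyond all thresholds and becomes rational; there
    -- 1 ≤ eε trades ε for 1/e.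
    dense-ℕ : ∀ n m → (fromℚ ½ + ε) * fromℕ n < fromℕ m → (e ℕ.+ 2) ℕ.* n ℕ.≤ 2 ℕ.* (e ℕ.* m)
    dense-ℕ n m lt = ι-cancel (begin
      ι ((e ℕ.+ 2) ℕ.* n)                               ≡⟨ trans (ι-* (e ℕ.+ 2) n) (cong (ℚ._* ι n) (ι-+ e 2)) ⟩
      (ι e ℚ.+ ι 2) ℚ.* ι n                             ≡⟨ solve 2 (λ e n → (e :+ con (ι 2)) :* n := e :* n :+ con (ι 2) :* (con 1ℚ :* n)) refl (ι e) (ι n) ⟩
      ι e ℚ.* ι n ℚ.+ ι 2 ℚ.* (1ℚ ℚ.* ι n)              ≤⟨ ℚ.+-monoʳ-≤ (ι e ℚ.* ι n) (*-sub (ι 2) (0≤ι 2)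
                                                             (ℚ.*-monoʳ-≤-nonNeg (ι n) {{ℚ.nonNegative (0≤ι n)}} (1≤eε i (ℕ.m≤m⊔n onset (from lt))))) ⟩
      ι e ℚ.* ι n ℚ.+ ι 2 ℚ.* (ι e ℚ.* x ℚ.* ι n)       ≡⟨ solve 3 (λ e n x → e :* n :+ con (ι 2) :* (e :* x :* n) := con (ι 2) :* (e :* ((con ½ :+ x) :* n))) refl (ι e) (ι n) x ⟩
      ι 2 ℚ.* (ι e ℚ.* ((½ ℚ.+ x) ℚ.* ι n))             ≤⟨ *-sub (ι 2) (0≤ι 2) (*-sub (ι e) (0≤ι e)
                                                             (ℚ.≤-trans (≤-by (ℚ.<⇒≤ (gap>0 lt)) refl) (spaced lt i (ℕ.m≤n⊔m onset (from lt))))) ⟩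
      ι 2 ℚ.* (ι e ℚ.* ι m)                             ≡⟨ sym (trans (ι-* 2 (e ℕ.* m)) (cong (ι 2 ℚ.*_) (ι-* e m))) ⟩
      ι (2 ℕ.* (e ℕ.* m))                               ∎)
      where
      i = onset ℕ.⊔ from lt
      x = seq ε i

    -- Multiply d l ≤ x⁴ n / 100 by 800 e². The left side is at least 400 e² d K because l ≥ K/2;
    -- the right side is 8 (e x)² x² n, at most 8 · 9 · ¼ · n = 18 n.
    sparse-ℚ : ∀ n d K x l r → 0ℚ ℚ.≤ x → x ℚ.≤ ½ → 0ℚ ℚ.≤ ι e ℚ.* x → ι e ℚ.* x ℚ.≤ ι 3 → 0ℚ ℚ.≤ l → l ℚ.* r ≡ 1ℚ → ι K ℚ.* ½ ℚ.≤ l →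
      ι d ℚ.≤ (+ 1 ℚ./ 100) ℚ.* (x ℚ.* (x ℚ.* (x ℚ.* (x ℚ.* 1ℚ)))) ℚ.* (ι n ℚ.* r) →
      ι 400 ℚ.* (ι e ℚ.* ι e ℚ.* (ι d ℚ.* ι K)) ℚ.≤ ι 18 ℚ.* ι n
    sparse-ℚ n d K x l r 0≤x x≤½ 0≤ex ex≤3 0≤l lr≡1 K≤l d≤ = begin
      ι 400 ℚ.* (E ℚ.* E ℚ.* (ι d ℚ.* ι K))
        ≡⟨ solve 3 (λ e d k → con (ι 400) :* (e :* e :* (d :* k)) := con (ι 800) :* ((e :* e) :* (d :* (k :* con ½)))) refl E (ι d) (ι K) ⟩
      ι 800 ℚ.* ((E ℚ.* E) ℚ.* (ι d ℚ.* (ι K ℚ.* ½)))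
        ≤⟨ *-sub (ι 800) (0≤ι 800) (*-sub (E ℚ.* E) 0≤EE (ℚ.≤-trans (*-sub (ι d) (0≤ι d) K≤l)
             (ℚ.*-monoʳ-≤-nonNeg l {{ℚ.nonNegative 0≤l}} d≤))) ⟩
      ι 800 ℚ.* ((E ℚ.* E) ℚ.* ((+ 1 ℚ./ 100) ℚ.* (x ℚ.* (x ℚ.* (x ℚ.* (x ℚ.* 1ℚ)))) ℚ.* (ι n ℚ.* r) ℚ.* l))
        ≡⟨ solve 5 (λ e x n r l → con (ι 800) :* ((e :* e) :* (con (+ 1 ℚ./ 100) :* (x :* (x :* (x :* (x :* con 1ℚ)))) :* (n :* r) :* l))
             := con (ι 8) :* ((((e :* x) :* (e :* x)) :* (x :* x)) :* (n :* (l :* r)))) refl E x (ι n) r l ⟩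
      ι 8 ℚ.* ((((E ℚ.* x) ℚ.* (E ℚ.* x)) ℚ.* (x ℚ.* x)) ℚ.* (ι n ℚ.* (l ℚ.* r)))
        ≡⟨ cong (λ y → ι 8 ℚ.* ((((E ℚ.* x) ℚ.* (E ℚ.* x)) ℚ.* (x ℚ.* x)) ℚ.* (ι n ℚ.* y))) lr≡1 ⟩
      ι 8 ℚ.* ((((E ℚ.* x) ℚ.* (E ℚ.* x)) ℚ.* (x ℚ.* x)) ℚ.* (ι n ℚ.* 1ℚ))
        ≤⟨ *-sub (ι 8) (0≤ι 8) (ℚ.*-monoʳ-≤-nonNeg (ι n ℚ.* 1ℚ) {{ℚ.nonNegative (*-nonNeg (0≤ι n) (0≤ι 1))}}
             (*-mono (*-nonNeg 0≤ex 0≤ex) (*-nonNeg (ℚ.<⇒≤ 0<½) (ℚ.<⇒≤ 0<½))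
               (*-mono 0≤ex (0≤ι 3) ex≤3 ex≤3) (*-mono 0≤x (ℚ.<⇒≤ 0<½) x≤½ x≤½))) ⟩
      ι 8 ℚ.* (((ι 3 ℚ.* ι 3) ℚ.* (½ ℚ.* ½)) ℚ.* (ι n ℚ.* 1ℚ))
        ≡⟨ solve 1 (λ n → con (ι 8) :* (((con (ι 3) :* con (ι 3)) :* (con ½ :* con ½)) :* (n :* con 1ℚ)) := con (ι 18) :* n) refl (ι n) ⟩
      ι 18 ℚ.* ι n ∎
      where
      E = ι e
      0≤EE = *-nonNeg (0≤ι e) (0≤ι e)

    -- From e + 1 ≤ 2e and K + 1 ≤ 2K the target is at most 8 e² d K; then 400 = 50 · 8 and 18 ≤ 50.
    absorb : ∀ d K n → 1 ℕ.≤ K → 400 ℕ.* (e ℕ.* e ℕ.* (d ℕ.* K)) ℕ.≤ 18 ℕ.* n → suc e ℕ.* d ℕ.* ((suc K ℕ.+ suc K) ℕ.* e) ℕ.≤ n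
    absorb d K n 1≤K le = ℕ.*-cancelˡ-≤ 50 (ℕ.≤-trans (ℕ.*-monoʳ-≤ 50 (ℕ.*-mono-≤
      (ℕ.*-monoˡ-≤ d (ℕ.+-monoˡ-≤ e (ℕ.≤-trans (s≤s z≤n) 2≤e)))
      (ℕ.*-monoˡ-≤ e (ℕ.+-mono-≤ (ℕ.+-monoˡ-≤ K 1≤K) (ℕ.+-monoˡ-≤ K 1≤K)))))
      (ℕ.≤-trans (ℕ.≤-reflexive (regroup e d K)) (ℕ.≤-trans le (ℕ.*-monoˡ-≤ n (ℕ.m≤m+n 18 32)))))
      where
      regroup : ∀ e d K → 50 ℕ.* ((e ℕ.+ e) ℕ.* d ℕ.* ((K ℕ.+ K ℕ.+ (K ℕ.+ K)) ℕ.* e)) ≡ 400 ℕ.* (e ℕ.* e ℕ.* (d ℕ.* K))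
      regroup = solve-∀

    sparse-ℕ : ∀ n d K (log>0 : 0ℝ < log n) → 1 ℕ.≤ K → 2 ℕ.^ K ℕ.≤ n →
      fromℕ d < fromℚ (+ 1 ℚ./ 100) * ε ^ 4 * (fromℕ n ÷ log n [ log>0 ]) →
      suc e ℕ.* d ℕ.* ((suc K ℕ.+ suc K) ℕ.* e) ℕ.≤ n
    sparse-ℕ n d K log>0 1≤K 2^K≤n lt = absorb d K n 1≤K (ι-cancel (subst₂ ℚ._≤_
      (sym (trans (ι-* 400 (e ℕ.* e ℕ.* (d ℕ.* K))) (cong (ι 400 ℚ.*_) (trans (ι-* (e ℕ.* e) (d ℕ.* K)) (cong₂ ℚ._*_ (ι-* e e) (ι-* d K))))))
      (sym (ι-* 18 n))
      (sparse-ℚ n d K (seq ε i) l (recip l) (0≤ε i s≤i) (ε≤½ i s≤i) (*-nonNeg (0≤ι e) (0≤ε i s≤i)) (eε≤3 i s≤i) (ℚ.<⇒≤ 0<l) (recip-inverse l 0<l) K≤l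
        (ℚ.≤-trans (≤-by (ℚ.<⇒≤ (gap>0 lt)) refl) (spaced lt i (ℕ.m⊔n≤o⇒n≤o (onset ℕ.⊔ n) (from lt) ℕ.≤-refl))))))
      where
      i = onset ℕ.⊔ n ℕ.⊔ from lt
      l = seq (log n) i
      sn≤i : onset ℕ.⊔ n ℕ.≤ i
      sn≤i = ℕ.m≤m⊔n (onset ℕ.⊔ n) (from lt)
      s≤i : onset ℕ.≤ i
      s≤i = ℕ.m⊔n≤o⇒m≤o onset n sn≤i
      K≤l : ι K ℚ.* ½ ℚ.≤ l
      K≤l = log-lower n K 2^K≤n i (ℕ.m⊔n≤o⇒n≤o onset n sn≤i)
      -- Positivity makes `recip l` a true inverse instead of the default value 0; it comes from K ≥
      -- 1.
      0<l : 0ℚ ℚ.< l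
      0<l = ℚ.<-≤-trans 0<½ (ℚ.≤-trans (subst (ℚ._≤ ι K ℚ.* ½) (ℚ.*-identityˡ ½)
        (ℚ.*-monoʳ-≤-nonNeg ½ (ι-mono 1≤K))) K≤l)

  n<2^n : ∀ n → n ℕ.< 2 ℕ.^ n
  n<2^n zero    = s≤s z≤n
  n<2^n (suc n) = ℕ.+-mono-≤ (ℕ.m^n>0 2 n) (ℕ.≤-trans (n<2^n n) (ℕ.m≤m+n (2 ℕ.^ n) 0))

  binary-logarithm : ∀ n → 2 ℕ.≤ n → ∃[ K ] 1 ℕ.≤ K × 2 ℕ.^ K ℕ.≤ n × n ℕ.< 2 ℕ.^ suc K
  binary-logarithm n 2≤n with crossing (λ K → n ℕ.<? 2 ℕ.^ K) (λ n<1 → contradiction (ℕ.≤-trans n<1 (s≤s z≤n)) (ℕ.≤⇒≯ 2≤n)) n (n<2^n n)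
  ... | zero  , _ , n<2   = contradiction n<2 (ℕ.≤⇒≯ 2≤n)
  ... | suc K , n≮ , n< = suc K , s≤s z≤n , ℕ.≮⇒≥ n≮ , n<

open import Data.Fin.Base using (Fin)
open import Data.Integer.Base using (+_)
open import Data.Nat.Base as ℕ using (ℕ; NonTrivial)
import Data.Nat.Properties as ℕ
open import Data.Product.Base using (∃-syntax; _,_)
open import Data.Rational.Base as ℚ using (½)
open import Data.Sum.Base using (_⊎_; inj₁; inj₂)
open import Relation.Binary.PropositionalEquality.Core using (_≡_)
open import Defs
open Embedding using (embeds)
open Reals using (module Scale; scale; dense-ℕ; sparse-ℕ; binary-logarithm)

theorem7 : (ε : ℝ) → 0ℝ < ε → ε < fromℚ ½ →
    ∃[ n₀ ] ((n : ℕ) → .{{_ : NonTrivial n}} → n ℕ.> n₀ →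
    (G H : BipartiteGraph n n) →
    ((x : Fin n ⊎ Fin n) → (fromℚ ½ + ε) * fromℕ n < fromℕ (degree G x)) →
    ((x : Fin n) → fromℕ (degree H (inj₁ x)) < fromℚ (+ 1 ℚ./ 100) * ε ^ 4 * (fromℕ n ÷ log n [ log>0 n ])) →
    ((y : Fin n) → degree H (inj₂ y) ≡ 1) →
    H EmbedsInto G)
-- The value n₀ = 1 suffices for every ε, since sparsity itself forces n to be large: some star has
-- a leaf, so its bound yields (e + 1) · 2 (K + 1) e ≤ n.
theorem7 ε 0<ε ε<½ = 1 , λ n n>1 G H dense sparse single →
  let K , 1≤K , 2^K≤n , n<2^1+K = binary-logarithm n n>1
  in embeds n (Scale.e S) K {{ℕ.>-nonZero (ℕ.<⇒≤ n>1)}} G H (Scale.2≤e S) n<2^1+K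
       (λ x → dense-ℕ S n (degree G x) (dense x))
       (λ s → sparse-ℕ S n (degree H (inj₁ s)) K (log>0 n) 1≤K 2^K≤n (sparse s))
       single
  where S = scale ε 0<ε ε<½
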